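{- For a positive integer $p$ and $n\ge 0$, let $a(n,p)$ be the total number of parts congruent to $0 \pmod{p}$, counted over all partitions of $n$ in which every part appears at most $p-1$ times. Then for all $n \geq 0$, $$a(5n+4,5) \equiv 0 \pmod{5},\qquad a(7n+5,7) \equiv 0 \pmod{7},\qquad a(11n+6,11) \equiv 0 \pmod{11}.$$ -}

module Defs where

open import Data.Nat using (ℕ; zero; suc; _+_; _∸_; _≤?_; _≟_)
open import Data.Nat.Divisibility using (_∣?_)
open import Data.List using (List; []; _∷_; _++_; map; length; filter)
open import Data.Nat.ListAction using (sum)
open import Data.Bool.ListAction using (all)
open import Data.Bool using (T?)
open import Data.Bool using (Bool; true; false; if_then_else_)
open import Relation.Nullary.Decidable using (does)

-- A partition is represented as a non-increasing list of positive parts.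
-- boundedParts f n m : all partitions of n into parts of size ≤ m, listed as
-- non-increasing lists, each exactly once.  f is fuel; it suffices that n + m ≤ f.
--   P(0 , m)       = { [] }
--   P(n+1, 0)      = {}
--   P(n , m+1)     = P(n , m) ∪ { (m+1) ∷ λ | λ ∈ P(n-(m+1), m+1) }   (if m+1 ≤ n)
boundedParts : ℕ → ℕ → ℕ → List (List ℕ)
boundedParts _       zero    _       = [] ∷ []
boundedParts zero    (suc _) _       = []
boundedParts (suc f) (suc n) zero    = []
boundedParts (suc f) (suc n) (suc m) =
  boundedParts f (suc n) m ++
  (if does (suc m ≤? suc n)
     then map (suc m ∷_) (boundedParts f (suc n ∸ suc m) (suc m))
     else [])

-- All partitions of n (parts ≤ n); fuel n + n suffices.
partitions : ℕ → List (List ℕ)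
partitions n = boundedParts (n + n) n n

mult : ℕ → List ℕ → ℕ
mult k λs = length (filter (λ x → x ≟ k) λs)

fewRepeats : ℕ → List ℕ → Bool
fewRepeats p λs = all (λ k → does (suc (mult k λs) ≤? p)) λs

partsDivBy : ℕ → List ℕ → ℕ
partsDivBy p λs = length (filter (λ x → p ∣? x) λs)

a : ℕ → ℕ → ℕ
a n p = sum (map (partsDivBy p) (filter (λ λs → T? (fewRepeats p λs)) (partitions n)))

{-# OPTIONS --safe #-}

-- Write E = ∏ (1 - qⁿ) and F = Σ a(n,p) qⁿ. Building partitions one part size k at a time multiplies the
-- generating function of p-regular partitions by (1 - qᵏᵖ)/(1 - qᵏ) and changes F by a further term only
-- when p ∣ k; hence E F involves only powers of qᵖ. If 3k + 1 = p l, then 1/E = (E³)ᵏ/Eᵖˡ, and Eᵖˡ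
-- involves only powers of qᵖ modulo p. So the coefficients of F in the class r vanish modulo p as soon as
-- those of (E³)ᵏ do, where k = 3, 2, 7 for p = 5, 7, 11.
--
-- By Jacobi, E³ = Σ (-1)ʲ (2j+1) qʲ⁽ʲ⁺¹⁾ᐟ²; modulo p the terms with p ∣ 2j+1 drop out, and for p = 5, 7 no
-- sum of k remaining exponents lies in the class r. For p = 11 (an idea of Hirschhorn), (E³)⁴ ≡ E · E¹¹, so
-- by the pentagonal number theorem its components in the classes 3, 6, 8, 9, 10 vanish; these are quartic
-- forms in the components of E³, and the class-6 component of (E³)⁷ lies in the ideal they generate.

module Submission where

open import Algebra.Bundles using (CommutativeRing; RawRing)
import Algebra.Properties.CommutativeSemiring.Exp
import Algebra.Solver.Ring
open import Algebra.Solver.Ring.AlmostCommutativeRing using (AlmostCommutativeRing; fromCommutativeRing; _-Raw-AlmostCommutative⟶_)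
open import Algebra.Structures using (IsCommutativeRing)
open import Data.Bool using (Bool; true; false; if_then_else_; T; T?; _∧_)
open import Data.Bool.ListAction using (all)
open import Data.Bool.Properties using (∧-zeroʳ)
open import Data.Fin using (toℕ; #_)
open import Data.Fin.Patterns
import Data.Fin.Properties as Fin
open import Data.Integer as ℤ using (ℤ; +_)
import Data.Integer.Divisibility.Signed as ℤ
import Data.Integer.Properties as ℤ
import Data.Integer.Tactic.RingSolver as ℤ
open import Data.List using (List; []; _∷_; _++_; map; filter; length)
open import Data.List.Properties using (++-identityʳ; map-++; map-∘; filter-accept; filter-reject)
open import Data.List.Relation.Unary.All as All using (All; []; _∷_)
import Data.List.Relation.Unary.All.Properties as All
open import Data.Maybe as Maybe using (Maybe; is-just; to-witness-T)
open import Data.Nat as ℕ using (ℕ; zero; suc; NonZero; _∸_; _≤?_; _≟_)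
open import Data.Nat.Divisibility using (_∣_; _∣?_; m%n≡0⇒n∣m; n∣m⇒m%n≡0)
open import Data.Nat.DivMod using (_%_; _mod_; m%n<n; %-distribˡ-+; %-distribˡ-*; m%n%n≡m%n; [m+kn]%n≡m%n; m<n⇒m%n≡m)
open import Data.Nat.ListAction using (sum)
open import Data.Nat.ListAction.Properties using (sum-++)
import Data.Nat.Properties as ℕ
import Data.Nat.Tactic.RingSolver as ℕ
open import Data.Product using (_×_; _,_; proj₁; proj₂)
open import Data.Vec using (tabulate; []; _∷_)
open import Data.Vec.Properties using (lookup∘tabulate)
open import Function using (_∘_)
open import Level using (0ℓ)
open import Relation.Binary.PropositionalEquality as ≡ using (_≡_; _≢_; refl; cong; cong₂; subst)
open import Relation.Nullary using (Dec; yes; no; ¬_; contradiction)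
open import Relation.Nullary.Decidable using (does; dec-true; dec-false; dec⇒maybe; from-yes; ¬?; _×-dec_; _→-dec_)

-- Why the class r is the right one: since 8 j(j+1)/2 + 1 = (2j+1)², a class t survives in E³ modulo
-- p exactly when 8t + 1 is a nonzero square, and 8r + k is 35, 42, 55, hence 0 modulo 5, 7, 11. The
-- class-r component of (E³)ᵏ therefore asks for k nonzero squares with sum 0 modulo p. Three such
-- squares never sum to 0 modulo 5, nor do two modulo 7; but seven can modulo 11, for instance
-- 1+1+1+1+1+1+5. Counting exponents fails there, and relations among the components have to take
-- its place.
--
-- Truncation leaves no room for limits, so the identities of Jacobi and Euler are proved by
-- induction as polynomial identities for finite products, in finite forms whose extra factors act
-- as 1, or whose extra terms vanish, once the number of factors reaches the truncation order.

module Residues (p : ℕ) where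

  infix 4 _≋_
  -- A record rather than a synonym for divisibility, so that `a` and `b` can be inferred from the
  -- type of a proof. It serves as the equality of a ring on ℤ itself, with no quotient formed.
  record _≋_ (a b : ℤ) : Set where
    constructor congruent
    field p∣a-b : + p ℤ.∣ a ℤ.- b
  open _≋_ public

  ≡⇒≋ : ∀ {a b} → a ≡ b → a ≋ b
  ≡⇒≋ {a} refl = congruent (ℤ.divides ℤ.0ℤ (ℤ.+-inverseʳ a))

  private
    via : ∀ {a b c} → + p ℤ.∣ c → c ≡ a ℤ.- b → a ≋ b
    via p∣c e = congruent (subst (+ p ℤ.∣_) e p∣c)

  ≋-sym : ∀ {a b} → a ≋ b → b ≋ a
  ≋-sym {a} {b} a≋b = via (ℤ.∣m⇒∣-m (p∣a-b a≋b)) (lemma a b)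
    where
    lemma : ∀ a b → ℤ.- (a ℤ.- b) ≡ b ℤ.- a
    lemma = ℤ.solve-∀

  ≋-trans : ∀ {a b c} → a ≋ b → b ≋ c → a ≋ c
  ≋-trans {a} {b} {c} a≋b b≋c = via (ℤ.∣m∣n⇒∣m+n (p∣a-b a≋b) (p∣a-b b≋c)) (lemma a b c)
    where
    lemma : ∀ a b c → (a ℤ.- b) ℤ.+ (b ℤ.- c) ≡ a ℤ.- c
    lemma = ℤ.solve-∀

  +-≋ : ∀ {a b c d} → a ≋ b → c ≋ d → a ℤ.+ c ≋ b ℤ.+ d
  +-≋ {a} {b} {c} {d} a≋b c≋d = via (ℤ.∣m∣n⇒∣m+n (p∣a-b a≋b) (p∣a-b c≋d)) (lemma a b c d)
    where
    lemma : ∀ a b c d → (a ℤ.- b) ℤ.+ (c ℤ.- d) ≡ (a ℤ.+ c) ℤ.- (b ℤ.+ d)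
    lemma = ℤ.solve-∀

  *-≋ : ∀ {a b c d} → a ≋ b → c ≋ d → a ℤ.* c ≋ b ℤ.* d
  *-≋ {a} {b} {c} {d} a≋b c≋d =
    via (ℤ.∣m∣n⇒∣m+n (ℤ.∣m⇒∣m*n c (p∣a-b a≋b)) (ℤ.∣n⇒∣m*n b (p∣a-b c≋d))) (lemma a b c d)
    where
    lemma : ∀ a b c d → (a ℤ.- b) ℤ.* c ℤ.+ b ℤ.* (c ℤ.- d) ≡ a ℤ.* c ℤ.- b ℤ.* d
    lemma = ℤ.solve-∀

  neg-≋ : ∀ {a b} → a ≋ b → ℤ.- a ≋ ℤ.- b
  neg-≋ {a} {b} a≋b = via (ℤ.∣m⇒∣-m (p∣a-b a≋b)) (lemma a b)
    where
    lemma : ∀ a b → ℤ.- (a ℤ.- b) ≡ (ℤ.- a) ℤ.- (ℤ.- b)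
    lemma = ℤ.solve-∀

  ring : CommutativeRing 0ℓ 0ℓ
  ring = record
    { Carrier = ℤ ; _≈_ = _≋_ ; _+_ = ℤ._+_ ; _*_ = ℤ._*_ ; -_ = ℤ.-_ ; 0# = ℤ.0ℤ ; 1# = ℤ.1ℤ
    ; isCommutativeRing = record
      { isRing = record
        { +-isAbelianGroup = record
          { isGroup = record
            { isMonoid = record
              { isSemigroup = record
                { isMagma = record
                  { isEquivalence = record { refl = ≡⇒≋ refl ; sym = ≋-sym ; trans = ≋-trans }
                  ; ∙-cong = +-≋ }
                ; assoc = λ a b c → ≡⇒≋ (ℤ.+-assoc a b c) }
              ; identity = (λ a → ≡⇒≋ (ℤ.+-identityˡ a)) , (λ a → ≡⇒≋ (ℤ.+-identityʳ a)) }
            ; inverse = (λ a → ≡⇒≋ (ℤ.+-inverseˡ a)) , (λ a → ≡⇒≋ (ℤ.+-inverseʳ a))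
            ; ⁻¹-cong = neg-≋ }
          ; comm = λ a b → ≡⇒≋ (ℤ.+-comm a b) }
        ; *-cong = *-≋
        ; *-assoc = λ a b c → ≡⇒≋ (ℤ.*-assoc a b c)
        ; *-identity = (λ a → ≡⇒≋ (ℤ.*-identityˡ a)) , (λ a → ≡⇒≋ (ℤ.*-identityʳ a))
        ; distrib = (λ a b c → ≡⇒≋ (ℤ.*-distribˡ-+ a b c)) , (λ a b c → ≡⇒≋ (ℤ.*-distribʳ-+ a b c)) }
      ; *-comm = λ a b → ≡⇒≋ (ℤ.*-comm a b) } }

-- Equality only sees the coefficients up to qᴹ, so this is the ring K[q]/(qᴹ⁺¹): there is nothing to
-- converge, and infinite products are finite ones.
module Truncated (K : CommutativeRing 0ℓ 0ℓ) (M : ℕ) where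
  private module K = CommutativeRing K
  open K using (_≈_)
  open import Algebra.Properties.CommutativeSemigroup K.+-commutativeSemigroup using (interchange)
  open import Relation.Binary.Reasoning.Setoid K.setoid

  Series : Set
  Series = ℕ → K.Carrier

  infix 4 _≈ˢ_
  record _≈ˢ_ (f g : Series) : Set where
    constructor coefficientwise
    field at : ∀ {n} → n ℕ.≤ M → f n ≈ g n
  open _≈ˢ_ public

  constant : K.Carrier → Series
  constant c zero    = c
  constant c (suc n) = K.0#

  infixl 6 _⊕_
  infixl 7 _⊛_
  opaque
    -- Opaque, so that expressions in series stay symbolic and do not unfold into convolutions; the
    -- `-at` equations give access to coefficients.
    _⊕_ : Series → Series → Series
    (f ⊕ g) n = f n K.+ g n

    _⊛_ : Series → Series → Series
    (f ⊛ g) zero    = f 0 K.* g 0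
    (f ⊛ g) (suc n) = f 0 K.* g (suc n) K.+ ((λ i → f (suc i)) ⊛ g) n

    ⊖_ : Series → Series
    (⊖ f) n = K.- f n

    ⊕-at : ∀ f g n → (f ⊕ g) n ≡ f n K.+ g n
    ⊕-at f g n = refl

    ⊖-at : ∀ f n → (⊖ f) n ≡ K.- f n
    ⊖-at f n = refl

    ⊛-at-0 : ∀ f g → (f ⊛ g) 0 ≡ f 0 K.* g 0
    ⊛-at-0 f g = refl

    ⊛-at-suc : ∀ f g n → (f ⊛ g) (suc n) ≡ f 0 K.* g (suc n) K.+ ((λ i → f (suc i)) ⊛ g) n
    ⊛-at-suc f g n = refl

  ≈ˢ-refl : ∀ {f} → f ≈ˢ f
  ≈ˢ-refl = coefficientwise λ _ → K.refl

  opaque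
    unfolding _⊕_ _⊛_ ⊖_

    -- The equation `i + j ≡ n` hands the caller both the bounds `i , j ≤ n` needed under truncation
    -- and the information on residue classes.
    ⊛-cong-at : ∀ n {f f′ g g′} → (∀ i j → i ℕ.+ j ≡ n → f i K.* g j ≈ f′ i K.* g′ j) →
                (f ⊛ g) n ≈ (f′ ⊛ g′) n
    ⊛-cong-at zero    h = h 0 0 refl
    ⊛-cong-at (suc n) h = K.+-cong (h 0 (suc n) refl) (⊛-cong-at n λ i j e → h (suc i) j (cong suc e))

    ⊛-zero-at : ∀ n {f g} → (∀ i j → i ℕ.+ j ≡ n → f i K.* g j ≈ K.0#) → (f ⊛ g) n ≈ K.0#
    ⊛-zero-at zero    h = h 0 0 refl
    ⊛-zero-at (suc n) h =
      K.trans (K.+-cong (h 0 (suc n) refl) (⊛-zero-at n λ i j e → h (suc i) j (cong suc e))) (K.+-identityˡ K.0#)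

    ⊛-distribʳ : ∀ n f f′ g → ((f ⊕ f′) ⊛ g) n ≈ (f ⊛ g) n K.+ (f′ ⊛ g) n
    ⊛-distribʳ zero    f f′ g = K.distribʳ _ _ _
    ⊛-distribʳ (suc n) f f′ g =
      K.trans (K.+-cong (K.distribʳ _ _ _) (⊛-distribʳ n _ _ g)) (interchange _ _ _ _)

    ⊛-scaleˡ : ∀ n c f g → ((λ i → c K.* f i) ⊛ g) n ≈ c K.* (f ⊛ g) n
    ⊛-scaleˡ zero    c f g = K.*-assoc _ _ _
    ⊛-scaleˡ (suc n) c f g =
      K.trans (K.+-cong (K.*-assoc _ _ _) (⊛-scaleˡ n c _ g)) (K.sym (K.distribˡ _ _ _))

    -- The definition peels off `f 0`; peeling off `g 0` is the same sum read from the other end,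
    -- which gives commutativity.
    ⊛-snoc : ∀ n f g → (f ⊛ g) (suc n) ≈ (f ⊛ (λ i → g (suc i))) n K.+ f (suc n) K.* g 0
    ⊛-snoc zero    f g = K.refl
    ⊛-snoc (suc n) f g = K.trans (K.+-congˡ (⊛-snoc n _ g)) (K.sym (K.+-assoc _ _ _))

    ⊛-comm : ∀ n f g → (f ⊛ g) n ≈ (g ⊛ f) n
    ⊛-comm zero    f g = K.*-comm _ _
    ⊛-comm (suc n) f g = begin
      f 0 K.* g (suc n) K.+ ((λ i → f (suc i)) ⊛ g) n ≈⟨ K.+-comm _ _ ⟩
      ((λ i → f (suc i)) ⊛ g) n K.+ f 0 K.* g (suc n) ≈⟨ K.+-cong (⊛-comm n _ g) (K.*-comm _ _) ⟩
      (g ⊛ (λ i → f (suc i))) n K.+ g (suc n) K.* f 0 ≈⟨ ⊛-snoc n g f ⟨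
      (g ⊛ f) (suc n)                                 ∎

    ⊛-assoc : ∀ n f g h → ((f ⊛ g) ⊛ h) n ≈ (f ⊛ (g ⊛ h)) n
    ⊛-assoc zero    f g h = K.*-assoc _ _ _
    ⊛-assoc (suc n) f g h = begin
      f 0 K.* g 0 K.* h (suc n) K.+ (((λ i → f 0 K.* g (suc i)) ⊕ (f₊ ⊛ g)) ⊛ h) n
        ≈⟨ K.+-cong (K.*-assoc _ _ _) (⊛-distribʳ n _ _ h) ⟩
      f 0 K.* (g 0 K.* h (suc n)) K.+ (((λ i → f 0 K.* g (suc i)) ⊛ h) n K.+ ((f₊ ⊛ g) ⊛ h) n)
        ≈⟨ K.+-congˡ (K.+-cong (⊛-scaleˡ n _ _ h) (⊛-assoc n _ g h)) ⟩
      f 0 K.* (g 0 K.* h (suc n)) K.+ (f 0 K.* ((λ i → g (suc i)) ⊛ h) n K.+ (f₊ ⊛ (g ⊛ h)) n)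
        ≈⟨ K.+-assoc _ _ _ ⟨
      (f 0 K.* (g 0 K.* h (suc n)) K.+ f 0 K.* ((λ i → g (suc i)) ⊛ h) n) K.+ (f₊ ⊛ (g ⊛ h)) n
        ≈⟨ K.+-congʳ (K.distribˡ _ _ _) ⟨
      f 0 K.* (g ⊛ h) (suc n) K.+ (f₊ ⊛ (g ⊛ h)) n ∎
      where
      f₊ : Series
      f₊ i = f (suc i)

    ⊛-constantˡ : ∀ n c f → (constant c ⊛ f) n ≈ c K.* f n
    ⊛-constantˡ zero    c f = K.refl
    ⊛-constantˡ (suc n) c f =
      K.trans (K.+-congˡ (⊛-zero-at n λ _ _ _ → K.zeroˡ _)) (K.+-identityʳ _)

    isCommutativeRing : IsCommutativeRing _≈ˢ_ _⊕_ _⊛_ ⊖_ (constant K.0#) (constant K.1#)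
    isCommutativeRing = record
        { isRing = record
          { +-isAbelianGroup = record
            { isGroup = record
              { isMonoid = record
                { isSemigroup = record
                  { isMagma = record
                    { isEquivalence = record
                      { refl  = ≈ˢ-refl
                      ; sym   = λ f≈g → coefficientwise λ n≤M → K.sym (at f≈g n≤M)
                      ; trans = λ f≈g g≈h → coefficientwise λ n≤M → K.trans (at f≈g n≤M) (at g≈h n≤M) }
                    ; ∙-cong = λ f≈f′ g≈g′ → coefficientwise λ n≤M → K.+-cong (at f≈f′ n≤M) (at g≈g′ n≤M) }
                  ; assoc = λ f g h → coefficientwise λ {n} _ → K.+-assoc (f n) (g n) (h n) }
                ; identity = (λ f → coefficientwise λ {n} _ → K.trans (K.+-congʳ (zero-at n)) (K.+-identityˡ _))
                           , (λ f → coefficientwise λ {n} _ → K.trans (K.+-congˡ (zero-at n)) (K.+-identityʳ _)) }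
              ; inverse = (λ f → coefficientwise λ {n} _ → K.trans (K.-‿inverseˡ _) (K.sym (zero-at n)))
                        , (λ f → coefficientwise λ {n} _ → K.trans (K.-‿inverseʳ _) (K.sym (zero-at n)))
              ; ⁻¹-cong = λ f≈g → coefficientwise λ n≤M → K.-‿cong (at f≈g n≤M) }
            ; comm = λ f g → coefficientwise λ {n} _ → K.+-comm (f n) (g n) }
          ; *-cong = λ f≈f′ g≈g′ → coefficientwise λ {n} n≤M → ⊛-cong-at n λ { i j refl →
              K.*-cong (at f≈f′ (ℕ.≤-trans (ℕ.m≤m+n i j) n≤M)) (at g≈g′ (ℕ.≤-trans (ℕ.m≤n+m j i) n≤M)) }
          ; *-assoc = λ f g h → coefficientwise λ {n} _ → ⊛-assoc n f g h
          ; *-identity = (λ f → coefficientwise λ {n} _ → identityˡ n f)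
                       , (λ f → coefficientwise λ {n} _ → K.trans (⊛-comm n f _) (identityˡ n f))
          ; distrib = (λ f g h → coefficientwise λ {n} _ →
                         K.trans (⊛-comm n f _) (K.trans (⊛-distribʳ n g h f) (K.+-cong (⊛-comm n g f) (⊛-comm n h f))))
                    , (λ f g h → coefficientwise λ {n} _ → ⊛-distribʳ n g h f) }
        ; *-comm = λ f g → coefficientwise λ {n} _ → ⊛-comm n f g }
      where
      zero-at : ∀ n → constant K.0# n ≈ K.0#
      zero-at zero    = K.refl
      zero-at (suc n) = K.refl
      identityˡ : ∀ n f → (constant K.1# ⊛ f) n ≈ f n
      identityˡ n f = K.trans (⊛-constantˡ n _ f) (K.*-identityˡ _)

  ring : CommutativeRing 0ℓ 0ℓ
  ring = record { isCommutativeRing = isCommutativeRing }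

-- Truncated power series in q over the integers modulo p

module QSeries (p M : ℕ) where
  open Residues p public
  open Truncated ring M public renaming (ring to seriesRing)
  private module K = CommutativeRing ring
  open CommutativeRing seriesRing public
    using (_+_; _*_; -_; 0#; 1#; setoid; *-comm; *-assoc)
    renaming ( refl to ≈-refl; sym to ≈-sym; trans to ≈-trans; reflexive to ≈-reflexive
             ; +-cong to +-≈; *-cong to *-≈; +-congˡ to +-≈ˡ; +-congʳ to +-≈ʳ; *-congˡ to *-≈ˡ; *-congʳ to *-≈ʳ
             ; -‿cong to neg-≈
             ; zeroˡ to *-zeroˡ; zeroʳ to *-zeroʳ; +-identityˡ to 0+; +-identityʳ to +0
             ; *-identityˡ to 1*; *-identityʳ to *1 )

  integers : RawRing 0ℓ 0ℓ
  integers = CommutativeRing.rawRing ℤ.+-*-commutativeRing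

  almostRing : AlmostCommutativeRing 0ℓ 0ℓ
  almostRing = fromCommutativeRing seriesRing

  -- Integer coefficients of the ring solver become constant series. How coefficients are compared
  -- is left open in `Solver`: exactly for identities over ℤ, modulo p for those that hold only
  -- there.
  constant-homomorphism : integers -Raw-AlmostCommutative⟶ almostRing
  constant-homomorphism = record
    { ⟦_⟧ = constant
    ; +-homo = λ a b → coefficientwise λ
        { {zero}  _ → ≡⇒≋ (≡.sym (⊕-at (constant a) (constant b) 0))
        ; {suc n} _ → ≡⇒≋ (≡.sym (⊕-at (constant a) (constant b) (suc n))) }
    ; *-homo = λ a b → coefficientwise λ
        { {zero}  _ → ≡⇒≋ (≡.sym (⊛-at-0 (constant a) (constant b)))
        ; {suc n} _ → K.sym (K.trans (⊛-constantˡ (suc n) a (constant b)) (K.zeroʳ a)) }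
    ; -‿homo = λ a → coefficientwise λ
        { {zero}  _ → ≡⇒≋ (≡.sym (⊖-at (constant a) 0))
        ; {suc n} _ → ≡⇒≋ (≡.sym (⊖-at (constant a) (suc n))) }
    ; 0-homo = ≈-refl
    ; 1-homo = ≈-refl }

  constant-cong : ∀ {a b} → a ≋ b → constant a ≈ˢ constant b
  constant-cong a≋b = coefficientwise λ { {zero} _ → a≋b ; {suc _} _ → K.refl }

  module Solver (decide : ∀ a b → Maybe (a ≋ b)) =
    Algebra.Solver.Ring integers almostRing constant-homomorphism (λ a b → Maybe.map constant-cong (decide a b))

  module IntegerSolver = Solver (λ a b → Maybe.map ≡⇒≋ (dec⇒maybe (a ℤ.≟ b)))

  0#-at : ∀ n → 0# n ≡ ℤ.0ℤ
  0#-at zero    = refl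
  0#-at (suc n) = refl

  q : Series
  q 1 = ℤ.1ℤ
  q _ = ℤ.0ℤ

  q^ : ℕ → Series
  q^ zero    = 1#
  q^ (suc n) = q * q^ n

  q*-zero : ∀ f → (q * f) 0 ≋ ℤ.0ℤ
  q*-zero f = ≡⇒≋ (⊛-at-0 q f)

  q*-suc : ∀ f n → (q * f) (suc n) ≋ f n
  q*-suc f n = K.trans (≡⇒≋ (⊛-at-suc q f n)) (K.trans (K.+-identityˡ _) (K.trans (⊛-cong-at n {g = f} λ { zero j e → K.refl ; (suc i) j e → K.refl })
    (K.trans (⊛-constantˡ n ℤ.1ℤ f) (K.*-identityˡ _))))

  q^-+ : ∀ m n → q^ (m ℕ.+ n) ≈ˢ q^ m * q^ n
  q^-+ zero    n = ≈-sym (1* _)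
  q^-+ (suc m) n = ≈-trans (*-≈ˡ (q^-+ m n)) (≈-sym (*-assoc _ _ _))

  q^-cong : ∀ {m n} → m ≡ n → q^ m ≈ˢ q^ n
  q^-cong refl = ≈-refl

  q^*-at : ∀ k f n → (q^ k * f) (k ℕ.+ n) ≋ f n
  q^*-at zero    f n = K.trans (⊛-constantˡ n ℤ.1ℤ f) (K.*-identityˡ _)
  q^*-at (suc k) f n =
    K.trans (⊛-assoc (suc (k ℕ.+ n)) q (q^ k) f) (K.trans (q*-suc (q^ k * f) (k ℕ.+ n)) (q^*-at k f n))

  q^*-below : ∀ k f {n} → n ℕ.< k → (q^ k * f) n ≋ ℤ.0ℤ
  q^*-below (suc k) f {zero}  n<k = K.trans (⊛-assoc 0 q (q^ k) f) (q*-zero (q^ k * f))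
  q^*-below (suc k) f {suc n} n<k =
    K.trans (⊛-assoc (suc n) q (q^ k) f) (K.trans (q*-suc (q^ k * f) n) (q^*-below k f (ℕ.≤-pred n<k)))

  q^-off : ∀ k {n} → n ≢ k → q^ k n ≋ ℤ.0ℤ
  q^-off zero    {zero}  n≢k = contradiction refl n≢k
  q^-off zero    {suc n} n≢k = K.refl
  q^-off (suc k) {zero}  n≢k = q*-zero (q^ k)
  q^-off (suc k) {suc n} n≢k = K.trans (q*-suc (q^ k) n) (q^-off k (n≢k ∘ cong suc))

  q^-vanishes : ∀ {k} → M ℕ.< k → q^ k ≈ˢ 0#
  q^-vanishes {k} M<k = coefficientwise λ { {n} n≤M →
    K.trans (q^-off k λ { refl → ℕ.<-irrefl refl (ℕ.<-≤-trans M<k n≤M) }) (≡⇒≋ (≡.sym (0#-at n))) }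

  -- A factor with constant term 1 is cancelled without constructing its inverse: once the
  -- coefficients of `f` below n vanish, the coefficient of `f * g` at n is `f n`.
  cancelʳ : ∀ f g → g 0 ≋ ℤ.1ℤ → f * g ≈ˢ 0# → f ≈ˢ 0#
  cancelʳ f g g0≋1 fg≈0 = coefficientwise λ {n} n≤M → K.trans (below (suc n) n≤M ℕ.≤-refl) (≡⇒≋ (≡.sym (0#-at n)))
    where
    below : ∀ k {n} → n ℕ.≤ M → n ℕ.< k → f n ≋ ℤ.0ℤ
    below (suc k) {n} n≤M (ℕ.s≤s n≤k) = K.trans (K.sym lemma) (K.trans (at fg≈0 n≤M) (≡⇒≋ (0#-at n)))
      where
      lemma : (f * g) n ≋ f n
      lemma = K.trans (⊛-cong-at n {g′ = 1#} termwise) (K.trans (⊛-comm n f 1#) (q^*-at 0 f n))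
        where
        termwise : ∀ i j → i ℕ.+ j ≡ n → f i ℤ.* g j ≋ f i ℤ.* 1# j
        termwise i zero    e    = K.*-congˡ {f i} g0≋1
        termwise i (suc j) refl = K.trans (K.*-congʳ {g (suc j)} fi≋0) (K.trans (K.zeroˡ (g (suc j))) (K.sym (K.zeroʳ (f i))))
          where
          fi≋0 = below k (ℕ.≤-trans (ℕ.m≤m+n i (suc j)) n≤M) (ℕ.<-≤-trans (ℕ.m<m+n i (ℕ.s≤s ℕ.z≤n)) n≤k)

-- Dissection into residue classes of exponents

module Dissection (p M : ℕ) .{{_ : NonZero p}} where
  open QSeries p M
  private module K = CommutativeRing ring

  infix 4 _~_
  _~_ : ℕ → ℕ → Set
  m ~ n = m % p ≡ n % p

  ~-+ : ∀ {m m′ n n′} → m ~ m′ → n ~ n′ → m ℕ.+ n ~ m′ ℕ.+ n′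
  ~-+ {m} {m′} {n} {n′} m~m′ n~n′ = ≡.trans (%-distribˡ-+ m n p)
    (≡.trans (cong₂ (λ x y → (x ℕ.+ y) % p) m~m′ n~n′) (≡.sym (%-distribˡ-+ m′ n′ p)))

  ~-* : ∀ {m m′ n n′} → m ~ m′ → n ~ n′ → m ℕ.* n ~ m′ ℕ.* n′
  ~-* {m} {m′} {n} {n′} m~m′ n~n′ = ≡.trans (%-distribˡ-* m n p)
    (≡.trans (cong₂ (λ x y → (x ℕ.* y) % p) m~m′ n~n′) (≡.sym (%-distribˡ-* m′ n′ p)))

  +p* : ∀ m k → m ℕ.+ p ℕ.* k ~ m
  +p* m k = ≡.trans (cong (λ x → (m ℕ.+ x) % p) (ℕ.*-comm p k)) ([m+kn]%n≡m%n m k p)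

  -- r + (p - 1) s stands for r - s.
  complement : ∀ s r → s ℕ.+ (r ℕ.+ ℕ.pred p ℕ.* s) ~ r
  complement s r = ≡.trans (cong (_% p) (≡.trans (lemma s r (ℕ.pred p)) (cong (λ x → r ℕ.+ x ℕ.* s) (ℕ.suc-pred p)))) (+p* r s)
    where
    lemma : ∀ s r k → s ℕ.+ (r ℕ.+ k ℕ.* s) ≡ r ℕ.+ (suc k) ℕ.* s
    lemma = ℕ.solve-∀

  +-cancelˡ-~ : ∀ s {i j} → s ℕ.+ i ~ s ℕ.+ j → i ~ j
  +-cancelˡ-~ s {i} {j} e = ≡.trans (≡.sym (lemma i)) (≡.trans (~-+ {m = ℕ.pred p ℕ.* s} refl e) (lemma j))
    where
    reorder : ∀ a s i → a ℕ.+ (s ℕ.+ i) ≡ s ℕ.+ (i ℕ.+ a)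
    reorder = ℕ.solve-∀
    lemma : ∀ i → ℕ.pred p ℕ.* s ℕ.+ (s ℕ.+ i) ~ i
    lemma i = ≡.trans (cong (_% p) (reorder (ℕ.pred p ℕ.* s) s i)) (complement s i)

  -- The grading by exponents modulo p; `Homogeneous 0` is the precise form of "involves only powers
  -- of qᵖ". The bound `n ≤ M` makes the property respect `≈ˢ`.
  record Homogeneous (s : ℕ) (f : Series) : Set where
    constructor homogeneous
    field vanishes : ∀ {n} → n ℕ.≤ M → ¬ n ~ s → f n ≋ ℤ.0ℤ
  open Homogeneous public

  Homogeneous-resp : ∀ {s f g} → f ≈ˢ g → Homogeneous s f → Homogeneous s g
  Homogeneous-resp f≈g hom = homogeneous λ n≤M n≁s → K.trans (K.sym (at f≈g n≤M)) (vanishes hom n≤M n≁s)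

  Homogeneous-~ : ∀ {s t f} → s ~ t → Homogeneous s f → Homogeneous t f
  Homogeneous-~ s~t hom = homogeneous λ n≤M n≁t → vanishes hom n≤M (λ n~s → n≁t (≡.trans n~s s~t))

  Homogeneous-0 : ∀ {s} → Homogeneous s 0#
  Homogeneous-0 = homogeneous λ {n} _ _ → ≡⇒≋ (0#-at n)

  Homogeneous-constant : ∀ c → Homogeneous 0 (constant c)
  Homogeneous-constant c = homogeneous λ { {zero} _ n≁0 → contradiction refl n≁0 ; {suc n} _ _ → K.refl }

  Homogeneous-+ : ∀ {s f g} → Homogeneous s f → Homogeneous s g → Homogeneous s (f + g)
  Homogeneous-+ hf hg = homogeneous λ {n} n≤M n≁s → K.trans (≡⇒≋ (⊕-at _ _ n)) (
    K.trans (K.+-cong (vanishes hf n≤M n≁s) (vanishes hg n≤M n≁s)) (K.+-identityˡ _))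

  Homogeneous-neg : ∀ {s f} → Homogeneous s f → Homogeneous s (- f)
  Homogeneous-neg {f = f} hf = homogeneous λ {n} n≤M n≁s → K.trans (≡⇒≋ (⊖-at f n)) (K.-‿cong (vanishes hf n≤M n≁s))

  Homogeneous-* : ∀ {s t f g} → Homogeneous s f → Homogeneous t g → Homogeneous (s ℕ.+ t) (f * g)
  Homogeneous-* {s} {t} {f} {g} hf hg = homogeneous λ {n} n≤M n≁s+t → ⊛-zero-at n λ i j e → termwise n≤M n≁s+t i j e
    where
    termwise : ∀ {n} → n ℕ.≤ M → ¬ n ~ s ℕ.+ t → ∀ i j → i ℕ.+ j ≡ n → f i ℤ.* g j ≋ ℤ.0ℤ
    termwise n≤M n≁s+t i j refl with i % p ℕ.≟ s % p
    ... | no i≁s  = K.trans (K.*-congʳ {g j} (vanishes hf (ℕ.≤-trans (ℕ.m≤m+n i j) n≤M) i≁s)) (K.zeroˡ (g j))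
    ... | yes i~s = K.trans (K.*-congˡ {f i} (vanishes hg (ℕ.≤-trans (ℕ.m≤n+m j i) n≤M) λ j~t →
                      n≁s+t (~-+ {i} {s} {j} {t} i~s j~t))) (K.zeroʳ (f i))

  Homogeneous-q^ : ∀ k → Homogeneous k (q^ k)
  Homogeneous-q^ k = homogeneous λ _ n≁k → q^-off k λ { refl → n≁k refl }

  component : ℕ → Series → Series
  component r f n = if does (n % p ℕ.≟ r % p) then f n else ℤ.0ℤ

  component-on : ∀ {r n} f → n ~ r → component r f n ≡ f n
  component-on {r} {n} f n~r = cong (if_then f n else ℤ.0ℤ) (dec-true (n % p ℕ.≟ r % p) n~r)

  component-off : ∀ {r n} f → ¬ n ~ r → component r f n ≡ ℤ.0ℤ
  component-off {r} {n} f n≁r = cong (if_then f n else ℤ.0ℤ) (dec-false (n % p ℕ.≟ r % p) n≁r)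

  component-~ : ∀ {r r′} f → r ~ r′ → component r f ≈ˢ component r′ f
  component-~ f r~r′ = coefficientwise λ {n} _ → ≡⇒≋ (cong (λ x → if does (n % p ℕ.≟ x) then f n else ℤ.0ℤ) r~r′)

  component-cong : ∀ r {f g} → f ≈ˢ g → component r f ≈ˢ component r g
  component-cong r {f} {g} f≈g = coefficientwise λ {n} n≤M → lemma n≤M (does (n % p ℕ.≟ r % p))
    where
    lemma : ∀ {n} → n ℕ.≤ M → ∀ b → (if b then f n else ℤ.0ℤ) ≋ (if b then g n else ℤ.0ℤ)
    lemma n≤M true  = at f≈g n≤M
    lemma n≤M false = K.refl

  component-+ : ∀ r f g → component r (f + g) ≈ˢ component r f + component r g
  component-+ r f g = coefficientwise λ {n} n≤M → K.trans (lemma n (does (n % p ℕ.≟ r % p))) (≡⇒≋ (≡.sym (⊕-at _ _ n)))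
    where
    lemma : ∀ n b → (if b then (f + g) n else ℤ.0ℤ) ≋ (if b then f n else ℤ.0ℤ) ℤ.+ (if b then g n else ℤ.0ℤ)
    lemma n true  = ≡⇒≋ (⊕-at f g n)
    lemma n false = K.refl

  component-homogeneous : ∀ r f → Homogeneous r (component r f)
  component-homogeneous r f = homogeneous λ _ n≁r → ≡⇒≋ (component-off f n≁r)

  component-other : ∀ {s r f} → Homogeneous s f → ¬ s ~ r → component r f ≈ˢ 0#
  component-other {s} {r} {f} hf s≁r = coefficientwise λ {n} n≤M → K.trans (lemma n≤M) (≡⇒≋ (≡.sym (0#-at n)))
    where
    lemma : ∀ {n} → n ℕ.≤ M → component r f n ≋ ℤ.0ℤ
    lemma {n} n≤M with n % p ℕ.≟ r % p
    ... | no n≁r  = ≡⇒≋ (component-off f n≁r)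
    ... | yes n~r = K.trans (≡⇒≋ (component-on f n~r)) (vanishes hf n≤M (λ n~s → s≁r (≡.trans (≡.sym n~s) n~r)))

  component-0 : ∀ r → component r 0# ≈ˢ 0#
  component-0 r = coefficientwise λ {n} _ → lemma n (does (n % p ℕ.≟ r % p))
    where
    lemma : ∀ n b → (if b then 0# n else ℤ.0ℤ) ≋ 0# n
    lemma n true  = K.refl
    lemma n false = ≡⇒≋ (≡.sym (0#-at n))

  -- A homogeneous factor merely shifts classes: `i ~ s` and `i + j ~ s + r` force `j ~ r`.
  component-* : ∀ {s f} → Homogeneous s f → ∀ r g → component (s ℕ.+ r) (f * g) ≈ˢ f * component r g
  component-* {s} {f} hf r g = coefficientwise lemma
    where
    lemma : ∀ {n} → n ℕ.≤ M → component (s ℕ.+ r) (f * g) n ≋ (f * component r g) n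
    lemma {n} n≤M with n % p ℕ.≟ (s ℕ.+ r) % p
    ... | yes n~s+r = K.trans (≡⇒≋ (component-on (f * g) n~s+r)) (⊛-cong-at n termwise)
      where
      termwise : ∀ i j → i ℕ.+ j ≡ n → f i ℤ.* g j ≋ f i ℤ.* component r g j
      termwise i j refl with i % p ℕ.≟ s % p
      ... | yes i~s = K.*-congˡ {f i} (≡⇒≋ (≡.sym (component-on g
              (+-cancelˡ-~ s (≡.trans (~-+ {s} {i} {j} {j} (≡.sym i~s) refl) n~s+r)))))
      ... | no i≁s  = K.trans (K.*-congʳ {g j} fi≋0) (K.trans (K.zeroˡ (g j)) (K.sym (K.trans (K.*-congʳ {component r g j} fi≋0) (K.zeroˡ (component r g j)))))
        where fi≋0 = vanishes hf (ℕ.≤-trans (ℕ.m≤m+n i j) n≤M) i≁s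
    ... | no n≁s+r = K.trans (≡⇒≋ (component-off (f * g) n≁s+r)) (K.sym (vanishes (Homogeneous-* hf (component-homogeneous r g)) n≤M n≁s+r))

  Σ< : ℕ → (ℕ → Series) → Series
  Σ< zero    t = 0#
  Σ< (suc k) t = t k + Σ< k t

  Σ<-cong : ∀ k {t u} → (∀ {i} → i ℕ.< k → t i ≈ˢ u i) → Σ< k t ≈ˢ Σ< k u
  Σ<-cong zero    t≈u = ≈-refl
  Σ<-cong (suc k) t≈u = +-≈ (t≈u ℕ.≤-refl) (Σ<-cong k (t≈u ∘ ℕ.m<n⇒m<1+n))

  Σ<-zero : ∀ k {t} → (∀ i → t i ≈ˢ 0#) → Σ< k t ≈ˢ 0#
  Σ<-zero zero    t≈0 = ≈-refl
  Σ<-zero (suc k) t≈0 = ≈-trans (+-≈ (t≈0 k) (Σ<-zero k t≈0)) (0+ 0#)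

  Σ<-*ʳ : ∀ k t g → Σ< k t * g ≈ˢ Σ< k (λ i → t i * g)
  Σ<-*ʳ zero    t g = *-zeroˡ g
  Σ<-*ʳ (suc k) t g = ≈-trans (CommutativeRing.distribʳ seriesRing g (t k) (Σ< k t)) (+-≈ˡ (Σ<-*ʳ k t g))

  component-Σ< : ∀ r k t → component r (Σ< k t) ≈ˢ Σ< k (λ i → component r (t i))
  component-Σ< r zero    t = component-0 r
  component-Σ< r (suc k) t = ≈-trans (component-+ r (t k) (Σ< k t)) (+-≈ˡ (component-Σ< r k t))

  Σ<-components : ∀ f → Σ< p (λ s → component s f) ≈ˢ f
  Σ<-components f = coefficientwise λ {n} _ → above p n ℕ.≤-refl (m%n<n n p)
    where
    below : ∀ k n → k ℕ.≤ n % p → Σ< k (λ s → component s f) n ≋ ℤ.0ℤ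
    below zero    n k≤ = ≡⇒≋ (0#-at n)
    below (suc k) n k≤ = K.trans (≡⇒≋ (⊕-at _ _ n)) (K.trans (K.+-cong (≡⇒≋ (component-off f λ n~k →
        ℕ.<⇒≢ k≤ (≡.sym (≡.trans n~k (m<n⇒m%n≡m (ℕ.<-trans k≤ (m%n<n n p))))))) (below k n (ℕ.<⇒≤ k≤))) (K.+-identityˡ _))
    above : ∀ k n → k ℕ.≤ p → n % p ℕ.< k → Σ< k (λ s → component s f) n ≋ f n
    above (suc k) n k<p (ℕ.s≤s n%p≤k) with n % p ℕ.≟ k
    ... | yes n%p≡k = K.trans (≡⇒≋ (⊕-at _ _ n)) (K.trans (K.+-cong (≡⇒≋ (component-on f (≡.trans n%p≡k (≡.sym (m<n⇒m%n≡m k<p)))))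
                        (below k n (ℕ.≤-reflexive (≡.sym n%p≡k)))) (K.+-identityʳ _))
    ... | no n%p≢k  = K.trans (≡⇒≋ (⊕-at _ _ n)) (K.trans (K.+-cong (≡⇒≋ (component-off f λ n~k → n%p≢k (≡.trans n~k (m<n⇒m%n≡m k<p))))
                        (above k n (ℕ.<⇒≤ k<p) (ℕ.≤∧≢⇒< n%p≤k n%p≢k))) (K.+-identityˡ _))

  component-product : ∀ r f g →
    component r (f * g) ≈ˢ Σ< p (λ s → component s f * component (r ℕ.+ ℕ.pred p ℕ.* s) g)
  component-product r f g = begin
    component r (f * g)                                       ≈⟨ component-cong r (*-≈ʳ (≈-sym (Σ<-components f))) ⟩
    component r (Σ< p (λ s → component s f) * g)              ≈⟨ component-cong r (Σ<-*ʳ p _ g) ⟩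
    component r (Σ< p (λ s → component s f * g))              ≈⟨ component-Σ< r p _ ⟩
    Σ< p (λ s → component r (component s f * g))              ≈⟨ Σ<-cong p (λ {s} _ → component-~ _ (≡.sym (complement s r))) ⟩
    Σ< p (λ s → component (s ℕ.+ (r ℕ.+ ℕ.pred p ℕ.* s)) (component s f * g))
      ≈⟨ Σ<-cong p (λ {s} _ → component-* (component-homogeneous s f) _ g) ⟩
    Σ< p (λ s → component s f * component (r ℕ.+ ℕ.pred p ℕ.* s) g) ∎
    where open import Relation.Binary.Reasoning.Setoid setoid

-- Finite forms of the identities of Jacobi and Euler

triangular : ℕ → ℕ
triangular zero    = 0
triangular (suc k) = suc k ℕ.+ triangular k

k≤triangular : ∀ k → k ℕ.≤ triangular k
k≤triangular zero    = ℕ.z≤n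
k≤triangular (suc k) = ℕ.m≤m+n (suc k) (triangular k)

2*triangular : ∀ k → 2 ℕ.* triangular k ≡ k ℕ.* suc k
2*triangular zero    = refl
2*triangular (suc k) = ≡.trans (distrib k (triangular k)) (≡.trans (cong (2 ℕ.* suc k ℕ.+_) (2*triangular k)) (square k))
  where
  distrib : ∀ k t → 2 ℕ.* (suc k ℕ.+ t) ≡ 2 ℕ.* suc k ℕ.+ 2 ℕ.* t
  distrib = ℕ.solve-∀
  square : ∀ k → 2 ℕ.* suc k ℕ.+ k ℕ.* suc k ≡ suc k ℕ.* suc (suc k)
  square = ℕ.solve-∀

module Theta (p M : ℕ) where
  open QSeries p M
  open IntegerSolver using (Polynomial; solve; _:=_; _:+_; _:*_; _:-_; :-_; con)
  open import Relation.Binary.Reasoning.Setoid setoid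

  one : ∀ {n} → Polynomial n
  one = con (+ 1)

  1-_ : Series → Series
  1- x = 1# + - x

  1-cong : ∀ {x y} → x ≈ˢ y → 1- x ≈ˢ 1- y
  1-cong x≈y = +-≈ˡ (neg-≈ x≈y)

  poch : ℕ → Series → Series
  poch zero    x = 1#
  poch (suc n) x = (1- x) * poch n (x * q)

  poch-cong : ∀ n {x y} → x ≈ˢ y → poch n x ≈ˢ poch n y
  poch-cong zero    x≈y = ≈-refl
  poch-cong (suc n) x≈y = *-≈ (1-cong x≈y) (poch-cong n (*-≈ʳ x≈y))

  poch-snoc : ∀ n x → poch (suc n) x ≈ˢ poch n x * (1- (x * q^ n))
  poch-snoc zero x = solve 1 (λ x → (one :- x) :* one := one :* (one :- x :* one)) ≈-refl x
  poch-snoc (suc n) x = begin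
    (1- x) * poch (suc n) (x * q)                           ≈⟨ *-≈ˡ (poch-snoc n (x * q)) ⟩
    (1- x) * (poch n (x * q) * (1- (x * q * q^ n)))         ≈⟨ *-assoc _ _ _ ⟨
    (1- x) * poch n (x * q) * (1- (x * q * q^ n))           ≈⟨ *-≈ˡ (1-cong (*-assoc x q (q^ n))) ⟩
    poch (suc n) x * (1- (x * q^ (suc n)))                  ∎

  -- Each factor 1 - x qʲ acts as 1 on anything that `x` annihilates; this is how finite products
  -- lose their extra factors under truncation.
  absorb : ∀ n {x y} → y * x ≈ˢ 0# → y * poch n x ≈ˢ y
  absorb zero        yx≈0 = *1 _
  absorb (suc n) {x} {y} yx≈0 = begin
    y * ((1- x) * poch n (x * q)) ≈⟨ solve 3 (λ y x z → y :* ((one :- x) :* z) := y :* z :- (y :* x) :* z) ≈-refl y x _ ⟩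
    y * z + - (y * x * z)         ≈⟨ +-≈ˡ (neg-≈ (≈-trans (*-≈ʳ yx≈0) (*-zeroˡ z))) ⟩
    y * z + - 0#                  ≈⟨ solve 1 (λ a → a :- con (+ 0) := a) ≈-refl (y * z) ⟩
    y * z                         ≈⟨ absorb n (≈-trans (≈-sym (*-assoc y x q)) (≈-trans (*-≈ʳ yx≈0) (*-zeroˡ q))) ⟩
    y                             ∎
    where z = poch n (x * q)

  -- Jacobi's identity for E³

  sign : ℕ → Series
  sign zero    = 1#
  sign (suc k) = - sign k

  odd : ℕ → Series
  odd zero    = 1#
  odd (suc k) = odd k + constant (+ 2)

  tri : ℕ → Series
  tri zero    = 1#
  tri (suc k) = q^ (suc k) * tri k

  tri≈q^ : ∀ k → tri k ≈ˢ q^ (triangular k)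
  tri≈q^ zero    = ≈-refl
  tri≈q^ (suc k) = ≈-trans (*-≈ˡ (tri≈q^ k)) (≈-sym (q^-+ (suc k) (triangular k)))

  jacobiTerm : ℕ → Series
  jacobiTerm k = sign k * odd k * tri k

  -- (q)ₙ (q)₂ₙ₊₁ / ((q)ₙ₋ₖ (q)ₙ₊ₖ₊₁) for n = i + k
  weight : ℕ → ℕ → Series
  weight i k = poch k (q * q^ i) * poch i (q^ i * q^ k * q^ k * q * q)

  -- Stands for `weight (i - 1) k`; the value 0 at `i = 0` is that of a q-binomial coefficient with
  -- lower index -1.
  weight⁻ : ℕ → ℕ → Series
  weight⁻ zero    k = 0#
  weight⁻ (suc i) k = weight i k

  jacobiTail : ℕ → ℕ → Series
  jacobiTail zero    k = 0#
  jacobiTail (suc i) k = jacobiTerm k * weight i k + jacobiTail i (suc k)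

  -- Up to a factor (q)ₙ the weight is the q-binomial coefficient [2n+1, n-k]. One form of the
  -- q-Pascal rule followed by the other reduces it to three coefficients with upper index 2n-1.
  -- Here `Q` is qⁿ, and `1- Q` is the quotient (q)ₙ/(q)ₙ₋₁.
  weight-recurrence : ∀ i k → let a = q * q^ i; b = q * q^ k; Q = a * b in
    weight (suc i) (suc k) ≈ˢ
    (1- Q) * ((1# + Q * Q) * weight i (suc k) + a * weight (suc i) k + a * b * b * q * weight⁻ i (suc (suc k)))
  weight-recurrence zero k = begin
    poch (suc k) (q * (q * 1#)) * ((1- (q * 1# * (q * t) * (q * t) * q * q)) * 1#)
      ≈⟨ *-≈ʳ (poch-snoc k (q * (q * 1#))) ⟩
    C * (1- (q * (q * 1#) * t)) * ((1- (q * 1# * (q * t) * (q * t) * q * q)) * 1#)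
      ≈⟨ solve 3 (λ q t C → C :* (one :- (q :* (q :* one) :* t)) :* ((one :- (q :* one :* (q :* t) :* (q :* t) :* q :* q)) :* one)
          := (one :- (q :* one) :* (q :* t)) :* ((one :+ (q :* one) :* (q :* t) :* ((q :* one) :* (q :* t))) :*
             ((one :- (q :* one)) :* C :* one) :+ (q :* one) :* (C :* ((one :- (q :* one :* t :* t :* q :* q)) :* one))
             :+ (q :* one) :* (q :* t) :* (q :* t) :* q :* con (+ 0)))
          ≈-refl q t C ⟩
    (1- Q) * ((1# + Q * Q) * ((1- a) * C * 1#) + a * weight 1 k + a * b * b * q * 0#)
      ≈⟨ *-≈ˡ (+-≈ʳ (+-≈ʳ (*-≈ˡ (*-≈ʳ (*-≈ˡ (poch-cong k (*-comm q _))))))) ⟩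
    (1- Q) * ((1# + Q * Q) * weight 0 (suc k) + a * weight 1 k + a * b * b * q * 0#) ∎
    where
    t = q^ k
    a = q * 1#
    b = q * t
    Q = a * b
    C = poch k (q * (q * 1#))
  weight-recurrence (suc j) k = begin
    poch (suc k) (q * (q * (q * v))) * poch (suc (suc j)) e
      ≈⟨ *-≈ (poch-snoc k _) (≈-trans (poch-snoc (suc j) e) (*-≈ʳ (poch-snoc j e))) ⟩
    C * (1- (q * (q * (q * v)) * t)) * (D * (1- (e * v)) * (1- (e * (q * v))))
      ≈⟨ solve 5 (λ q v t C D → let a = q :* (q :* v); b = q :* t; Q = a :* b; e = q :* (q :* v) :* (q :* t) :* (q :* t) :* q :* q in
           C :* (one :- q :* (q :* (q :* v)) :* t) :* (D :* (one :- e :* v) :* (one :- e :* (q :* v))) :=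
           (one :- Q) :* ((one :+ Q :* Q) :* ((one :- a) :* C :* ((one :- q :* v :* (q :* t) :* (q :* t) :* q :* q) :* D))
             :+ a :* (C :* ((one :- q :* (q :* v) :* t :* t :* q :* q) :* ((one :- q :* (q :* v) :* t :* t :* q :* q :* q) :* D)))
             :+ a :* b :* b :* q :* ((one :- q :* v) :* ((one :- q :* v :* q) :* C) :* D)))
           ≈-refl q v t C D ⟩
    (1- Q) * ((1# + Q * Q) * ((1- a) * C * ((1- (q * v * (q * t) * (q * t) * q * q)) * D))
      + a * (C * ((1- (q * (q * v) * t * t * q * q)) * ((1- (q * (q * v) * t * t * q * q * q)) * D)))
      + a * b * b * q * ((1- (q * v)) * ((1- (q * v * q)) * C) * D))
      ≈⟨ *-≈ˡ (+-≈ (+-≈ (*-≈ˡ (*-≈ (*-≈ˡ (poch-cong k (solve 2 (λ q v → q :* (q :* (q :* v)) := q :* (q :* v) :* q) ≈-refl q v)))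
             (*-≈ˡ (poch-cong j (solve 3 (λ q v t → q :* (q :* v) :* (q :* t) :* (q :* t) :* q :* q := q :* v :* (q :* t) :* (q :* t) :* q :* q :* q) ≈-refl q v t)))))
           (*-≈ˡ (*-≈ˡ (*-≈ˡ (*-≈ˡ (poch-cong j (solve 3 (λ q v t → q :* (q :* v) :* (q :* t) :* (q :* t) :* q :* q := q :* (q :* v) :* t :* t :* q :* q :* q :* q) ≈-refl q v t)))))))
           (*-≈ˡ (*-≈ (*-≈ˡ (*-≈ˡ (poch-cong k (solve 2 (λ q v → q :* (q :* (q :* v)) := q :* v :* q :* q) ≈-refl q v))))
             (poch-cong j (solve 3 (λ q v t → q :* (q :* v) :* (q :* t) :* (q :* t) :* q :* q := v :* (q :* (q :* t)) :* (q :* (q :* t)) :* q :* q) ≈-refl q v t))))) ⟩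
    (1- Q) * ((1# + Q * Q) * weight (suc j) (suc k) + a * weight (suc (suc j)) k + a * b * b * q * weight j (suc (suc k))) ∎
    where
    v = q^ j
    t = q^ k
    a = q * (q * v)
    b = q * t
    Q = a * b
    e = q * (q * v) * (q * t) * (q * t) * q * q
    C = poch k (q * (q * (q * v)))
    D = poch j e

  -- At k = 0 the left neighbour would be k = -1; the symmetry [2n-1, n] = [2n-1, n-1] folds it back
  -- onto k = 0, whence the summand `Q` in the coefficient of `weight i 0`.
  weight-0-recurrence : ∀ i → let Q = q * q^ i in
    weight (suc i) 0 ≈ˢ (1- Q) * ((1# + Q + Q * Q) * weight i 0 + Q * q * weight⁻ i 1)
  weight-0-recurrence zero =
    solve 1 (λ q → one :* ((one :- q :* one :* one :* one :* q :* q) :* one) :=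
      (one :- q :* one) :* ((one :+ q :* one :+ q :* one :* (q :* one)) :* (one :* one) :+ q :* one :* q :* con (+ 0)))
      ≈-refl q
  weight-0-recurrence (suc j) = begin
    1# * poch (suc (suc j)) e
      ≈⟨ *-≈ˡ (≈-trans (poch-snoc (suc j) e) (*-≈ʳ (poch-snoc j e))) ⟩
    1# * (D * (1- (e * v)) * (1- (e * (q * v))))
      ≈⟨ solve 3 (λ q v D → let Q = q :* (q :* v); e = q :* (q :* v) :* one :* one :* q :* q in
           one :* (D :* (one :- e :* v) :* (one :- e :* (q :* v))) :=
           (one :- Q) :* ((one :+ Q :+ Q :* Q) :* (one :* ((one :- q :* v :* one :* one :* q :* q) :* D))
             :+ Q :* q :* ((one :- q :* v) :* one :* D)))
           ≈-refl q v D ⟩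
    (1- Q) * ((1# + Q + Q * Q) * (1# * ((1- (q * v * 1# * 1# * q * q)) * D)) + Q * q * ((1- (q * v)) * 1# * D))
      ≈⟨ *-≈ˡ (+-≈ (*-≈ˡ (*-≈ˡ (*-≈ˡ (poch-cong j (solve 2 (λ q v → q :* (q :* v) :* one :* one :* q :* q := q :* v :* one :* one :* q :* q :* q) ≈-refl q v)))))
           (*-≈ˡ (*-≈ˡ (poch-cong j (solve 2 (λ q v → q :* (q :* v) :* one :* one :* q :* q := v :* (q :* one) :* (q :* one) :* q :* q) ≈-refl q v))))) ⟩
    (1- Q) * ((1# + Q + Q * Q) * weight (suc j) 0 + Q * q * weight j 1) ∎
    where
    v = q^ j
    Q = q * (q * v)
    e = q * (q * v) * 1# * 1# * q * q
    D = poch j e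

  -- The two correction terms are what the shifts k ± 1 in the recurrence for the weights leave at the
  -- lower end of the sum.
  jacobiTail-recurrence : ∀ i k → let Q = q^ i * (q * q^ k) in
    jacobiTail (suc i) (suc k) ≈ˢ
    (1- Q) * ((1- Q) * (1- Q) * jacobiTail i (suc k)
      + - (sign k * Q * ((odd k + constant (+ 2)) * tri k * weight i k + odd k * tri (suc k) * weight⁻ i (suc k))))
  jacobiTail-recurrence zero k = begin
    - sign k * (odd k + two) * (q * t * tri k) * (poch (suc k) (q * 1#) * 1#) + 0#
      ≈⟨ +-≈ʳ (*-≈ˡ (*-≈ʳ (poch-snoc k (q * 1#)))) ⟩
    - sign k * (odd k + two) * (q * t * tri k) * (C * (1- (q * 1# * t)) * 1#) + 0#
      ≈⟨ solve 6 (λ q t σ o T C → let Q = one :* (q :* t) in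
           :- σ :* (o :+ con (+ 2)) :* (q :* t :* T) :* (C :* (one :- (q :* one :* t)) :* one) :+ con (+ 0) :=
           (one :- Q) :* ((one :- Q) :* (one :- Q) :* con (+ 0)
             :- (σ :* Q :* ((o :+ con (+ 2)) :* T :* (C :* one) :+ o :* (q :* t :* T) :* con (+ 0)))))
           ≈-refl q t (sign k) (odd k) (tri k) C ⟩
    (1- Q) * ((1- Q) * (1- Q) * 0#
      + - (sign k * Q * ((odd k + two) * tri k * (C * 1#) + odd k * (q * t * tri k) * 0#))) ∎
    where
    two = constant (+ 2)
    t = q^ k
    Q = 1# * (q * t)
    C = poch k (q * 1#)
  jacobiTail-recurrence (suc i) k = begin
    - sign k * (odd k + two) * (b * tri k) * weight (suc i) (suc k) + jacobiTail (suc i) (suc (suc k))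
      ≈⟨ +-≈ (*-≈ˡ (weight-recurrence i k)) (jacobiTail-recurrence i (suc k)) ⟩
    - sign k * (odd k + two) * (b * tri k)
        * ((1- (a * b)) * ((1# + a * b * (a * b)) * W₁ + a * W₂ + a * b * b * q * W₃))
      + (1- Q′) * ((1- Q′) * (1- Q′) * Z
          + - (- sign k * Q′ * ((odd k + two + two) * (b * tri k) * W₁ + (odd k + two) * (q * b * (b * tri k)) * W₃)))
      -- The coefficient of `W₁` rests on (o+2)(1 + Q²) - Q(o+4) = (o+2)(1 - Q)² + Q o: the
      -- neighbour o+4 arrives through the tail, while o stays behind in the correction. `Q′` and
      -- `Q` are the same power of q.
      ≈⟨ solve 10 (λ q u t σ o T W₁ W₂ W₃ Z → let a = q :* u; b = q :* t; Q = a :* b; Q′ = u :* (q :* b); two = con (+ 2) in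
           :- σ :* (o :+ two) :* (b :* T) :* ((one :- Q) :* ((one :+ Q :* Q) :* W₁ :+ a :* W₂ :+ a :* b :* b :* q :* W₃))
           :+ (one :- Q′) :* ((one :- Q′) :* (one :- Q′) :* Z
             :- (:- σ :* Q′ :* ((o :+ two :+ two) :* (b :* T) :* W₁ :+ (o :+ two) :* (q :* b :* (b :* T)) :* W₃))) :=
           (one :- Q) :* ((one :- Q) :* (one :- Q) :* (:- σ :* (o :+ two) :* (b :* T) :* W₁ :+ Z)
             :- (σ :* Q :* ((o :+ two) :* T :* W₂ :+ o :* (b :* T) :* W₁))))
           ≈-refl q u t (sign k) (odd k) (tri k) W₁ W₂ W₃ Z ⟩
    (1- (a * b)) * ((1- (a * b)) * (1- (a * b)) * (- sign k * (odd k + two) * (b * tri k) * W₁ + Z)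
      + - (sign k * (a * b) * ((odd k + two) * tri k * W₂ + odd k * (b * tri k) * W₁))) ∎
    where
    two = constant (+ 2)
    u = q^ i
    t = q^ k
    a = q * u
    b = q * t
    Q′ = u * (q * b)
    W₁ = weight i (suc k)
    W₂ = weight (suc i) k
    W₃ = weight⁻ i (suc (suc k))
    Z  = jacobiTail i (suc (suc k))

  -- Differentiating the finite Jacobi triple product gives Σ (-1)ᵏ (2k+1) qᵏ⁽ᵏ⁺¹⁾ᐟ² [2n+1, n-k] =
  -- (q)ₙ². This is that identity times (q)ₙ, the factor with which the weights tend to 1. Passing
  -- from n to n + 1 multiplies both sides by (1 - Q)³.
  finite-jacobi : ∀ i → jacobiTail (suc i) 0 ≈ˢ poch i q * poch i q * poch i q
  finite-jacobi zero = solve 0 (one :* one :* one :* (one :* one) :+ con (+ 0) := one :* one :* one) ≈-refl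
  finite-jacobi (suc i) = begin
    1# * 1# * 1# * weight (suc i) 0 + jacobiTail (suc i) 1
      ≈⟨ +-≈ (*-≈ˡ (weight-0-recurrence i)) (jacobiTail-recurrence i 0) ⟩
    1# * 1# * 1# * ((1- Q) * ((1# + Q + Q * Q) * W + Q * q * W′))
      + (1- Q′) * ((1- Q′) * (1- Q′) * Z + - (1# * Q′ * ((1# + constant (+ 2)) * 1# * W + 1# * (q * 1# * 1#) * W′)))
      -- At the lower end 1 + Q + Q² - 3Q = (1 - Q)², and the two multiples of `W′` cancel.
      ≈⟨ solve 5 (λ q u W W′ Z → let Q = q :* u; Q′ = u :* (q :* one) in
           one :* one :* one :* ((one :- Q) :* ((one :+ Q :+ Q :* Q) :* W :+ Q :* q :* W′))
           :+ (one :- Q′) :* ((one :- Q′) :* (one :- Q′) :* Z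
                :- (one :* Q′ :* ((one :+ con (+ 2)) :* one :* W :+ one :* (q :* one :* one) :* W′))) :=
           (one :- Q) :* (one :- Q) :* (one :- Q) :* (one :* one :* one :* W :+ Z))
           ≈-refl q u W W′ Z ⟩
    (1- Q) * (1- Q) * (1- Q) * jacobiTail (suc i) 0
      ≈⟨ *-≈ˡ (finite-jacobi i) ⟩
    (1- Q) * (1- Q) * (1- Q) * (P * P * P)
      ≈⟨ solve 2 (λ x P → x :* x :* x :* (P :* P :* P) := P :* x :* (P :* x) :* (P :* x)) ≈-refl (1- Q) P ⟩
    P * (1- Q) * (P * (1- Q)) * (P * (1- Q))
      ≈⟨ *-≈ (*-≈ snoc snoc) snoc ⟨
    poch (suc i) q * poch (suc i) q * poch (suc i) q ∎
    where
    u  = q^ i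
    Q  = q * u
    Q′ = u * (q * 1#)
    W  = weight i 0
    W′ = weight⁻ i 1
    Z  = jacobiTail i 1
    P  = poch i q
    snoc = poch-snoc i q

  -- The exponent k(k+1)/2 of `tri k` is at least k, so multiplying by `x` = qⁱ⁺¹ pushes it beyond i
  -- + k ≥ M; the argument `y` of the other product is a multiple of `x`.
  weight-negligible : ∀ {i k} → M ℕ.≤ i ℕ.+ k → jacobiTerm k * weight i k ≈ˢ jacobiTerm k
  weight-negligible {i} {k} M≤i+k = begin
    c * tri k * (poch k x * poch i y) ≈⟨ solve 4 (λ c t a b → c :* t :* (a :* b) := c :* (t :* a :* b)) ≈-refl c (tri k) _ _ ⟩
    c * (tri k * poch k x * poch i y) ≈⟨ *-≈ˡ (*-≈ʳ (absorb k tx≈0)) ⟩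
    c * (tri k * poch i y)            ≈⟨ *-≈ˡ (absorb i ty≈0) ⟩
    c * tri k                         ∎
    where
    c = sign k * odd k
    x = q * q^ i
    y = q^ i * q^ k * q^ k * q * q
    tx≈0 : tri k * x ≈ˢ 0#
    tx≈0 = ≈-trans (*-≈ʳ (tri≈q^ k)) (≈-trans (≈-sym (q^-+ (triangular k) (suc i))) (q^-vanishes
      (ℕ.≤-trans (ℕ.s≤s (ℕ.≤-trans M≤i+k (ℕ.≤-trans (ℕ.+-monoʳ-≤ i (k≤triangular k)) (ℕ.≤-reflexive (ℕ.+-comm i (triangular k))))))
        (ℕ.≤-reflexive (≡.sym (ℕ.+-suc (triangular k) i))))))
    ty≈0 : tri k * y ≈ˢ 0#
    ty≈0 = begin
      tri k * y                             ≈⟨ solve 4 (λ T u t q → T :* (u :* t :* t :* q :* q) := T :* (q :* u) :* (t :* t :* q)) ≈-refl (tri k) (q^ i) (q^ k) q ⟩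
      tri k * x * (q^ k * q^ k * q)         ≈⟨ *-≈ʳ tx≈0 ⟩
      0# * (q^ k * q^ k * q)                ≈⟨ *-zeroˡ _ ⟩
      0#                                    ∎

  -- (-1)ᵏ (q)ₙ/(q)ₖ qᵏⁿ⁺ᵏ⁽ᵏ⁺¹⁾ᐟ² for n = i + k: the summand in Shanks' finite form of the pentagonal
  -- number theorem.
  shanksTerm : ℕ → ℕ → Series
  shanksTerm i k = sign k * poch i (q * q^ k) * q^ (k ℕ.* (i ℕ.+ k) ℕ.+ triangular k)

  shanksTail : ℕ → ℕ → Series
  shanksTail zero    k = shanksTerm 0 k
  shanksTail (suc i) k = shanksTerm (suc i) k + shanksTail i (suc k)

  -- For m = n + 1 the exponents are m(3m-1)/2 and m(3m+1)/2, written without halving and in the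
  -- shape of those in `shanksTerm`.
  pentagonalPair : ℕ → Series
  pentagonalPair n = sign (suc n) *
    (q^ (suc n ℕ.* n ℕ.+ triangular (suc n)) + q^ (suc n ℕ.* suc n ℕ.+ triangular (suc n)))

  private
    exponent-i : ∀ i k → q^ (k ℕ.* (suc i ℕ.+ k) ℕ.+ triangular k) ≈ˢ q^ k * q^ (k ℕ.* (i ℕ.+ k) ℕ.+ triangular k)
    exponent-i i k = ≈-trans (q^-cong (lemma i k (triangular k))) (q^-+ k _)
      where
      lemma : ∀ i k t → k ℕ.* (suc i ℕ.+ k) ℕ.+ t ≡ k ℕ.+ (k ℕ.* (i ℕ.+ k) ℕ.+ t)
      lemma = ℕ.solve-∀

    exponent-k : ∀ i k → q^ (suc k ℕ.* (i ℕ.+ suc k) ℕ.+ triangular (suc k)) ≈ˢ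
                         q^ (suc (i ℕ.+ k)) * q^ (suc k) * q^ (k ℕ.* (suc i ℕ.+ k) ℕ.+ triangular k)
    exponent-k i k = ≈-trans (q^-cong (lemma i k (triangular k))) (≈-trans (q^-+ (suc (i ℕ.+ k) ℕ.+ suc k) _) (*-≈ʳ (q^-+ (suc (i ℕ.+ k)) (suc k))))
      where
      lemma : ∀ i k t → suc k ℕ.* (i ℕ.+ suc k) ℕ.+ (suc k ℕ.+ t) ≡ (suc (i ℕ.+ k) ℕ.+ suc k) ℕ.+ (k ℕ.* (suc i ℕ.+ k) ℕ.+ t)
      lemma = ℕ.solve-∀

  -- The last factor of the product is 1 - qⁿ with n = i + k + 2. Its 1 yields the first summand;
  -- its -qⁿ changes the sign and raises the exponent to the one belonging to k + 1 and n - 1.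
  shanksTerm-recurrence : ∀ i k →
    shanksTerm (suc (suc i)) k ≈ˢ q^ k * shanksTerm (suc i) k + (1- (q * q^ k)) * shanksTerm i (suc k)
  shanksTerm-recurrence i k = begin
    sign k * poch (suc (suc i)) x * q^ (k ℕ.* (suc (suc i) ℕ.+ k) ℕ.+ triangular k)
      ≈⟨ *-≈ (*-≈ˡ (poch-snoc (suc i) x)) (exponent-i (suc i) k) ⟩
    sign k * ((1- x) * C * (1- (x * q^ (suc i)))) * (t * e)
      ≈⟨ solve 6 (λ q t u σ C e → let x = q :* t in
           σ :* ((one :- x) :* C :* (one :- x :* (q :* u))) :* (t :* e) :=
           t :* (σ :* ((one :- x) :* C) :* e) :+ (one :- x) :* (:- σ :* C :* (q :* (u :* t) :* (q :* t) :* e)))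
           ≈-refl q t (q^ i) (sign k) C e ⟩
    t * (sign k * ((1- x) * C) * e) + (1- x) * (- sign k * C * (q * (q^ i * t) * (q * t) * e))
      ≈⟨ +-≈ˡ (*-≈ˡ (*-≈ (*-≈ˡ (poch-cong i (*-comm (q * t) q))) (≈-trans (*-≈ʳ (*-≈ʳ (*-≈ˡ (≈-sym (q^-+ i k))))) (≈-sym (exponent-k i k))))) ⟩
    t * shanksTerm (suc i) k + (1- x) * shanksTerm i (suc k) ∎
    where
    t = q^ k
    x = q * t
    C = poch i (x * q)
    e = q^ (k ℕ.* (suc i ℕ.+ k) ℕ.+ triangular k)

  -- With k general the induction telescopes: the correction at k + 1 cancels against the second
  -- summand of the recurrence for terms, and the pair of pentagonal exponents is produced at the
  -- far end i = 0. At k = 0 the correction carries the factor 1 - q⁰ = 0.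
  shanksTail-recurrence : ∀ i k →
    shanksTail (suc i) k ≈ˢ shanksTail i k + - ((1- q^ k) * shanksTerm i k) + pentagonalPair (i ℕ.+ k)
  shanksTail-recurrence zero k = begin
    sign k * ((1- (q * t)) * 1#) * q^ (k ℕ.* suc k ℕ.+ triangular k) + - sign k * 1# * e₂
      ≈⟨ +-≈ʳ (*-≈ˡ (exponent-i 0 k)) ⟩
    sign k * ((1- (q * t)) * 1#) * (t * e) + - sign k * 1# * e₂
      ≈⟨ solve 5 (λ q t σ e e₂ → σ :* ((one :- q :* t) :* one) :* (t :* e) :+ :- σ :* one :* e₂ :=
            σ :* one :* e :- (one :- t) :* (σ :* one :* e) :+ :- σ :* (q :* t :* (t :* e) :+ e₂)) ≈-refl q t (sign k) e e₂ ⟩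
    sign k * 1# * e + - ((1- t) * (sign k * 1# * e)) + - sign k * (q * t * (t * e) + e₂)
      ≈⟨ +-≈ˡ (*-≈ˡ (+-≈ʳ e₁-lemma)) ⟩
    sign k * 1# * e + - ((1- t) * (sign k * 1# * e)) + - sign k * (q^ (suc k ℕ.* k ℕ.+ triangular (suc k)) + e₂) ∎
    where
    t = q^ k
    e = q^ (k ℕ.* k ℕ.+ triangular k)
    e₂ = q^ (suc k ℕ.* suc k ℕ.+ triangular (suc k))
    lemma : ∀ k t → suc k ℕ.* k ℕ.+ (suc k ℕ.+ t) ≡ suc k ℕ.+ (k ℕ.+ (k ℕ.* k ℕ.+ t))
    lemma = ℕ.solve-∀
    e₁-lemma : q * t * (t * e) ≈ˢ q^ (suc k ℕ.* k ℕ.+ triangular (suc k))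
    e₁-lemma = ≈-sym (≈-trans (q^-cong (lemma k (triangular k))) (≈-trans (q^-+ (suc k) _) (*-≈ˡ (q^-+ k _))))
  shanksTail-recurrence (suc i) k = begin
    shanksTerm (suc (suc i)) k + shanksTail (suc i) (suc k)
      ≈⟨ +-≈ (shanksTerm-recurrence i k) (≈-trans (shanksTail-recurrence i (suc k)) (+-≈ˡ (≈-reflexive (cong pentagonalPair (ℕ.+-suc i k))))) ⟩
    t * a + (1- (q * t)) * b + (c + - ((1- (q * t)) * b) + d)
      ≈⟨ solve 6 (λ q t a b c d → t :* a :+ (one :- q :* t) :* b :+ (c :- (one :- q :* t) :* b :+ d) :=
            a :+ c :- (one :- t) :* a :+ d) ≈-refl q t a b c d ⟩
    a + c + - ((1- t) * a) + d ∎
    where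
    t = q^ k
    a = shanksTerm (suc i) k
    b = shanksTerm i (suc k)
    c = shanksTail i (suc k)
    d = pentagonalPair (suc i ℕ.+ k)

  shanksTail-suc : ∀ n → shanksTail (suc n) 0 ≈ˢ shanksTail n 0 + pentagonalPair n
  shanksTail-suc n = ≈-trans (shanksTail-recurrence n 0) (≈-trans
    (solve 3 (λ a b c → a :- (one :- one) :* b :+ c := a :+ c) ≈-refl _ (shanksTerm n 0) _)
    (+-≈ˡ (≈-reflexive (cong pentagonalPair (ℕ.+-identityʳ n)))))

  shanksTail-vanishes : ∀ i k → M ℕ.≤ i ℕ.+ suc k → shanksTail i (suc k) ≈ˢ 0#
  shanksTail-vanishes = go
    where
    term : ∀ i k → M ℕ.≤ i ℕ.+ suc k → shanksTerm i (suc k) ≈ˢ 0#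
    term i k M≤ = ≈-trans (*-≈ˡ (q^-vanishes bound)) (*-zeroʳ _)
      where
      bound : M ℕ.< suc k ℕ.* (i ℕ.+ suc k) ℕ.+ triangular (suc k)
      bound = ℕ.≤-<-trans (ℕ.≤-trans M≤ (ℕ.m≤m+n (i ℕ.+ suc k) (k ℕ.* (i ℕ.+ suc k)))) (ℕ.m<m+n _ (ℕ.s≤s ℕ.z≤n))
    go : ∀ i k → M ℕ.≤ i ℕ.+ suc k → shanksTail i (suc k) ≈ˢ 0#
    go zero    k M≤ = term 0 k M≤
    go (suc i) k M≤ = ≈-trans (+-≈ (term (suc i) k M≤)
      (go i (suc k) (ℕ.≤-trans M≤ (ℕ.≤-reflexive (≡.sym (ℕ.+-suc i (suc k))))))) (0+ 0#)

  -- For n ≥ M the terms with k ≥ 1 have exponents above M, and the term k = 0 is (q)ₙ itself.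
  shanksTail≈poch : ∀ n → M ℕ.≤ n → shanksTail n 0 ≈ˢ poch n q
  shanksTail≈poch zero    M≤n = solve 0 (one :* one :* one := one) ≈-refl
  shanksTail≈poch (suc n) M≤n = begin
    1# * poch (suc n) (q * 1#) * 1# + shanksTail n 1
      ≈⟨ +-≈ (solve 1 (λ x → one :* x :* one := x) ≈-refl _) (shanksTail-vanishes n 0 (ℕ.≤-trans M≤n (ℕ.≤-reflexive (≡.sym (ℕ.+-comm n 1))))) ⟩
    poch (suc n) (q * 1#) + 0# ≈⟨ +0 _ ⟩
    poch (suc n) (q * 1#)      ≈⟨ poch-cong (suc n) (*1 q) ⟩
    poch (suc n) q             ∎

-- Components of powers of E³ modulo p

module Congruences (p M : ℕ) .{{_ : NonZero p}} where
  open QSeries p M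
  open Dissection p M
  open Theta p M
  open import Relation.Binary.Reasoning.Setoid setoid
  private module K = CommutativeRing ring
  open IntegerSolver using (solve; _:=_) renaming (_:*_ to _∙_)

  open Algebra.Properties.CommutativeSemiring.Exp (CommutativeRing.commutativeSemiring seriesRing) public
    using (_^_; ^-congˡ; ^-distrib-*; ^-assocʳ)

  module ModularSolver = Solver (λ a b → Maybe.map congruent (dec⇒maybe (+ p ℤ.∣? (a ℤ.- b))))
  open ModularSolver using (Polynomial; Env; ⟦_⟧; _:+_; _:*_; con; var)

  -- Normal forms are compared with coefficients modulo p. The hypothesis is a boolean that
  -- evaluates to true on concrete polynomials, so an identity modulo p is proved by computation.
  same-normal-form : ∀ {m} (a b : Polynomial m) (ρ : Env m) →
                     T (is-just (ModularSolver.normalise a ModularSolver.≟N ModularSolver.normalise b)) → ⟦ a ⟧ ρ ≈ˢ ⟦ b ⟧ ρ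
  same-normal-form a b ρ ok = ≈-trans (≈-sym (ModularSolver.correct a ρ)) (≈-trans
    (ModularSolver.⟦ to-witness-T (ModularSolver.normalise a ModularSolver.≟N ModularSolver.normalise b) ok ⟧N-cong ρ)
    (ModularSolver.correct b ρ))

  Σ<ᴾ : ∀ {m} → ℕ → (ℕ → Polynomial m) → Polynomial m
  Σ<ᴾ zero    P = con (+ 0)
  Σ<ᴾ (suc k) P = P k :+ Σ<ᴾ k P

  infixl 7 _⊠_
  -- Multiplication in a ring graded by ℤ/p, carried out on symbolic components: a cyclic
  -- convolution.
  _⊠_ : ∀ {m} (P Q : ℕ → Polynomial m) → ℕ → Polynomial m
  (P ⊠ Q) r = Σ<ᴾ p (λ s → P s :* Q ((r ℕ.+ ℕ.pred p ℕ.* s) % p))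

  record Components {m} (ρ : Env m) (f : Series) (P : ℕ → Polynomial m) : Set where
    constructor components
    field component≈ : ∀ {r} → r ℕ.< p → component r f ≈ˢ ⟦ P r ⟧ ρ
  open Components public

  ⟦Σ<ᴾ⟧ : ∀ {m} (ρ : Env m) k P → ⟦ Σ<ᴾ k P ⟧ ρ ≈ˢ Σ< k (λ s → ⟦ P s ⟧ ρ)
  ⟦Σ<ᴾ⟧ ρ zero    P = ≈-refl
  ⟦Σ<ᴾ⟧ ρ (suc k) P = +-≈ˡ (⟦Σ<ᴾ⟧ ρ k P)

  ⊠-components : ∀ {m} {ρ : Env m} {f g P Q} → Components ρ f P → Components ρ g Q → Components ρ (f * g) (P ⊠ Q)
  ⊠-components {ρ = ρ} {f} {g} {P} {Q} fP gQ = components λ {r} r<p → begin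
    component r (f * g)                                                          ≈⟨ component-product r f g ⟩
    Σ< p (λ s → component s f * component (r ℕ.+ ℕ.pred p ℕ.* s) g)              ≈⟨ Σ<-cong p (λ {s} s<p → *-≈ (component≈ fP s<p) (reduced (r ℕ.+ ℕ.pred p ℕ.* s))) ⟩
    Σ< p (λ s → ⟦ P s ⟧ ρ * ⟦ Q ((r ℕ.+ ℕ.pred p ℕ.* s) % p) ⟧ ρ)                ≈⟨ ⟦Σ<ᴾ⟧ ρ p _ ⟨
    ⟦ (P ⊠ Q) r ⟧ ρ                                                              ∎
    where
    reduced : ∀ s → component s g ≈ˢ ⟦ Q (s % p) ⟧ ρ
    reduced s = ≈-trans (component-~ g (≡.sym (m%n%n≡m%n s p))) (component≈ gQ (m%n<n s p))

  Homogeneous-^ : ∀ {f s} n → Homogeneous s f → Homogeneous (n ℕ.* s) (f ^ n)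
  Homogeneous-^ zero    hf = Homogeneous-constant ℤ.1ℤ
  Homogeneous-^ (suc n) hf = Homogeneous-* hf (Homogeneous-^ n hf)

  -- Kept as a hypothesis until p is a numeral; then both sides expand to polynomials in one
  -- variable whose coefficients agree modulo p.
  Freshman : Set
  Freshman = ∀ x → (1- x) ^ p ≈ˢ 1- (x ^ p)

  -- Each factor turns into 1 - xᵖ, and p times any class is class 0. The class of `x` is arbitrary
  -- because the recursion replaces `x` by `x * q`.
  poch^p-homogeneous : Freshman → ∀ n {x s} → Homogeneous s x → Homogeneous 0 (poch n x ^ p)
  poch^p-homogeneous freshman zero    hx = Homogeneous-resp (≈-sym (1^ p)) (Homogeneous-constant ℤ.1ℤ)
    where
    1^ : ∀ n → 1# ^ n ≈ˢ 1#
    1^ zero    = ≈-refl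
    1^ (suc n) = ≈-trans (1* _) (1^ n)
  poch^p-homogeneous freshman (suc n) {x} {s} hx =
    Homogeneous-resp (≈-sym (≈-trans (^-distrib-* (1- x) (poch n (x * q)) p) (*-≈ʳ (freshman x))))
      (Homogeneous-* (Homogeneous-+ (Homogeneous-constant ℤ.1ℤ) (Homogeneous-neg (Homogeneous-~ p*s~0 (Homogeneous-^ p hx))))
        (poch^p-homogeneous freshman n (Homogeneous-* hx (Homogeneous-resp (*1 q) (Homogeneous-q^ 1)))))
    where
    p*s~0 : p ℕ.* s ~ 0
    p*s~0 = +p* 0 s

  poch-at-0 : ∀ n x → x 0 ≋ ℤ.0ℤ → poch n x 0 ≋ ℤ.1ℤ
  poch-at-0 zero    x x0≋0 = K.refl
  poch-at-0 (suc n) x x0≋0 = K.trans (≡⇒≋ (⊛-at-0 (1- x) (poch n (x * q)))) (*-≋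
    (K.trans (≡⇒≋ (⊕-at 1# (- x) 0)) (K.+-congˡ {ℤ.1ℤ} (K.trans (≡⇒≋ (⊖-at x 0)) (K.-‿cong x0≋0))))
    (poch-at-0 n (x * q) (K.trans (≡⇒≋ (⊛-at-0 x q)) (K.trans (K.*-congʳ {ℤ.0ℤ} x0≋0) (K.zeroˡ ℤ.0ℤ)))))

  ^-at-0 : ∀ f n → f 0 ≋ ℤ.1ℤ → (f ^ n) 0 ≋ ℤ.1ℤ
  ^-at-0 f zero    f0≋1 = K.refl
  ^-at-0 f (suc n) f0≋1 = K.trans (≡⇒≋ (⊛-at-0 f (f ^ n))) (*-≋ f0≋1 (^-at-0 f n f0≋1))

  euler cube : Series
  euler = poch M q
  cube  = euler * euler * euler

  -- Division by Eᵖˡ becomes a cancellation: `H` and `euler * f` are homogeneous of class 0, so both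
  -- pass through `component r`, and `H` has constant term 1.
  component-quotient : Freshman → ∀ f → Homogeneous 0 (euler * f) → ∀ k l → p ℕ.* l ≡ suc (k ℕ.* 3) →
                       ∀ r → component r (cube ^ k) ≈ˢ 0# → component r f ≈ˢ 0#
  component-quotient freshman f hom k l pl≡3k+1 r cube-vanishes = cancelʳ (component r f) H H0≋1 (begin
    component r f * H                           ≈⟨ *-comm _ _ ⟩
    H * component r f                           ≈⟨ component-* hH r f ⟨
    component r (H * f)                         ≈⟨ component-cong r (*-≈ʳ H≈) ⟩
    component r (euler * cube ^ k * f)          ≈⟨ component-cong r (solve 3 (λ e c f → e ∙ c ∙ f := e ∙ f ∙ c) ≈-refl euler (cube ^ k) f) ⟩
    component r (euler * f * cube ^ k)          ≈⟨ component-* hom r (cube ^ k) ⟩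
    euler * f * component r (cube ^ k)          ≈⟨ *-≈ˡ cube-vanishes ⟩
    euler * f * 0#                              ≈⟨ *-zeroʳ _ ⟩
    0#                                          ∎)
    where
    H = (euler ^ p) ^ l
    hH : Homogeneous 0 H
    hH = Homogeneous-~ (cong (_% p) (ℕ.*-zeroʳ l))
           (Homogeneous-^ l (poch^p-homogeneous freshman M (Homogeneous-resp (*1 q) (Homogeneous-q^ 1))))
    H0≋1 : H 0 ≋ ℤ.1ℤ
    H0≋1 = ^-at-0 (euler ^ p) l (^-at-0 euler p (poch-at-0 M q K.refl))
    cube≈ : cube ≈ˢ euler ^ 3
    cube≈ = solve 1 (λ e → e ∙ e ∙ e := e ∙ (e ∙ (e ∙ one))) ≈-refl euler
    H≈ : H ≈ˢ euler * cube ^ k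
    H≈ = begin
      (euler ^ p) ^ l               ≈⟨ ^-assocʳ euler p l ⟩
      euler ^ (p ℕ.* l)             ≡⟨ cong (euler ^_) (≡.trans pl≡3k+1 (cong suc (ℕ.*-comm k 3))) ⟩
      euler * euler ^ (3 ℕ.* k)     ≈⟨ *-≈ˡ (^-assocʳ euler 3 k) ⟨
      euler * (euler ^ 3) ^ k       ≈⟨ *-≈ˡ (^-congˡ k cube≈) ⟨
      euler * cube ^ k              ∎

  %-~ : ∀ k → k % p ~ k
  %-~ k = m%n%n≡m%n k p

  -- Only triangular exponents occur in E³, and those k(k+1)/2 with p ∣ 2k+1 have coefficient zero.
  Missing : ℕ → Set
  Missing r = ∀ {k} → k ℕ.< p → k ℕ.* suc k ~ 2 ℕ.* r → suc (2 ℕ.* k) ~ 0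

  missing? : ∀ r → Dec (Missing r)
  missing? r = ℕ.allUpTo? (λ k → ((k ℕ.* suc k) % p ℕ.≟ (2 ℕ.* r) % p) →-dec (suc (2 ℕ.* k) % p ℕ.≟ 0 % p)) p

  -- Doubled, a triangular number is a polynomial in k, so k may be reduced modulo p; this leaves
  -- the finitely many cases that `missing?` decides.
  square-mod : ∀ k r → triangular k ~ r → (k % p) ℕ.* suc (k % p) ~ 2 ℕ.* r
  square-mod k r Tk~r =
    ≡.trans (~-* {k % p} {k} {suc (k % p)} {suc k} (%-~ k) (~-+ {1} {1} {k % p} {k} refl (%-~ k)))
      (≡.trans (cong (_% p) (≡.sym (2*triangular k))) (~-* {2} {2} {triangular k} {r} refl Tk~r))

  missing-odd : ∀ {r} → Missing r → ∀ k → triangular k ~ r → suc (2 ℕ.* k) ~ 0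
  missing-odd {r} missing k Tk~r =
    ≡.trans (~-+ {1} {1} {2 ℕ.* k} {2 ℕ.* (k % p)} refl (~-* {2} {2} {k} {k % p} refl (≡.sym (%-~ k))))
      (missing (m%n<n k p) (square-mod k r Tk~r))

  odd≈constant : ∀ k → odd k ≈ˢ constant (+ suc (2 ℕ.* k))
  odd≈constant zero    = ≈-refl
  odd≈constant (suc k) = ≈-trans (+-≈ʳ (odd≈constant k)) (≈-trans (≈-sym (C.+-homo (+ suc (2 ℕ.* k)) (+ 2)))
    (constant-cong (≡⇒≋ (cong +_ (lemma k)))))
    where
    module C = _-Raw-AlmostCommutative⟶_ constant-homomorphism
    lemma : ∀ k → suc (2 ℕ.* k) ℕ.+ 2 ≡ suc (2 ℕ.* suc k)
    lemma = ℕ.solve-∀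

  ~0⇒≋0 : ∀ {m} → m ~ 0 → + m ≋ ℤ.0ℤ
  ~0⇒≋0 {m} m~0 = congruent (subst (+ p ℤ.∣_) (≡.sym (ℤ.+-identityʳ (+ m))) (ℤ.∣ᵤ⇒∣ (m%n≡0⇒n∣m m p (≡.trans m~0 (m<n⇒m%n≡m (ℕ.>-nonZero⁻¹ p))))))

  sign-homogeneous : ∀ k → Homogeneous 0 (sign k)
  sign-homogeneous zero    = Homogeneous-constant ℤ.1ℤ
  sign-homogeneous (suc k) = Homogeneous-neg (sign-homogeneous k)

  component-jacobiTerm : ∀ {r} → Missing r → ∀ k → component r (jacobiTerm k) ≈ˢ 0#
  component-jacobiTerm {r} missing k with triangular k % p ℕ.≟ r % p
  ... | yes Tk~r = ≈-trans (component-cong r (≈-trans (*-≈ʳ (*-≈ˡ odd≈0)) (≈-trans (*-≈ʳ (*-zeroʳ _)) (*-zeroˡ _)))) (component-0 r)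
    where
    odd≈0 : odd k ≈ˢ 0#
    odd≈0 = ≈-trans (odd≈constant k) (constant-cong (~0⇒≋0 (missing-odd missing k Tk~r)))
  ... | no Tk≁r  = component-other (Homogeneous-* {t = triangular k}
      (Homogeneous-* (sign-homogeneous k) (Homogeneous-resp (≈-sym (odd≈constant k)) (Homogeneous-constant (+ suc (2 ℕ.* k)))))
      (Homogeneous-resp (≈-sym (tri≈q^ k)) (Homogeneous-q^ (triangular k)))) Tk≁r

  component-cube : ∀ {r} → Missing r → component r cube ≈ˢ 0#
  component-cube {r} missing = ≈-trans (component-cong r (≈-sym (finite-jacobi M)))
    -- This is the finite form with n = M. The sum i + k stays above M throughout `tail`, so every
    -- weight acts as 1 on its term.
    (tail (suc M) 0 (ℕ.≤-reflexive (≡.sym (ℕ.+-identityʳ (suc M)))))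
    where
    tail : ∀ i k → M ℕ.< i ℕ.+ k → component r (jacobiTail i k) ≈ˢ 0#
    tail zero    k M<i+k = component-0 r
    tail (suc i) k M<i+k = ≈-trans (component-+ r _ _) (≈-trans (+-≈
      (≈-trans (component-cong r (weight-negligible {i} {k} (ℕ.≤-pred M<i+k))) (component-jacobiTerm missing k))
      (tail i (suc k) (ℕ.≤-trans M<i+k (ℕ.≤-reflexive (≡.sym (ℕ.+-suc i k)))))) (0+ 0#))

  NotPentagonal : ℕ → Set
  NotPentagonal r = (¬ 0 ~ r) × (∀ {n} → n ℕ.< p →
    (¬ 2 ℕ.* (suc n ℕ.* n) ℕ.+ suc n ℕ.* suc (suc n) ~ 2 ℕ.* r) ×
    (¬ 2 ℕ.* (suc n ℕ.* suc n) ℕ.+ suc n ℕ.* suc (suc n) ~ 2 ℕ.* r))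

  notPentagonal? : ∀ r → Dec (NotPentagonal r)
  notPentagonal? r = ¬? (0 % p ℕ.≟ r % p) ×-dec ℕ.allUpTo? (λ n →
    ¬? ((2 ℕ.* (suc n ℕ.* n) ℕ.+ suc n ℕ.* suc (suc n)) % p ℕ.≟ (2 ℕ.* r) % p) ×-dec
    ¬? ((2 ℕ.* (suc n ℕ.* suc n) ℕ.+ suc n ℕ.* suc (suc n)) % p ℕ.≟ (2 ℕ.* r) % p)) p

  -- Summing `shanksTail-suc` writes E as 1 plus pentagonal pairs, and no exponent among them lies
  -- in the class r; exponents are doubled so that n may be reduced modulo p.
  component-euler : ∀ r → NotPentagonal r → component r euler ≈ˢ 0#
  component-euler r (0≁r , excluded) =
    ≈-trans (component-cong r (≈-sym (shanksTail≈poch M ℕ.≤-refl))) (partial M)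
    where
    exponents : ∀ {x y} n → x ℕ.+ triangular (suc n) ~ r → y ~ x →
                2 ℕ.* y ℕ.+ suc (n % p) ℕ.* suc (suc (n % p)) ~ 2 ℕ.* r
    exponents {x} {y} n e y~x = ≡.trans
      (~-+ {2 ℕ.* y} {2 ℕ.* x} {suc (n % p) ℕ.* suc (suc (n % p))} {suc n ℕ.* suc (suc n)}
        (~-* {2} {2} {y} {x} refl y~x)
        (~-* {suc (n % p)} {suc n} {suc (suc (n % p))} {suc (suc n)}
          (~-+ {1} {1} {n % p} {n} refl (%-~ n)) (~-+ {2} {2} {n % p} {n} refl (%-~ n))))
      (≡.trans (cong (_% p) (≡.trans (cong (2 ℕ.* x ℕ.+_) (≡.sym (2*triangular (suc n)))) (≡.sym (ℕ.*-distribˡ-+ 2 x _))))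
        (~-* {2} {2} {x ℕ.+ triangular (suc n)} {r} refl e))
    pair : ∀ n → component r (pentagonalPair n) ≈ˢ 0#
    pair n = ≈-trans (component-* (sign-homogeneous (suc n)) r _) (≈-trans (*-≈ˡ (≈-trans (component-+ r _ _)
      (≈-trans (+-≈
        (component-other (Homogeneous-q^ _) λ e → proj₁ (excluded (m%n<n n p))
          (exponents n e (~-* {suc (n % p)} {suc n} {n % p} {n} (~-+ {1} {1} {n % p} {n} refl (%-~ n)) (%-~ n))))
        (component-other (Homogeneous-q^ _) λ e → proj₂ (excluded (m%n<n n p))
          (exponents n e (~-* {suc (n % p)} {suc n} {suc (n % p)} {suc n}
            (~-+ {1} {1} {n % p} {n} refl (%-~ n)) (~-+ {1} {1} {n % p} {n} refl (%-~ n))))))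
        (0+ 0#)))) (*-zeroʳ _))
    partial : ∀ n → component r (shanksTail n 0) ≈ˢ 0#
    partial zero    = component-other
      (Homogeneous-resp (solve 0 (one := one ∙ one ∙ one) ≈-refl) (Homogeneous-constant ℤ.1ℤ)) 0≁r
    partial (suc n) = ≈-trans (component-cong r (shanksTail-suc n)) (≈-trans (component-+ r _ _)
      (≈-trans (+-≈ (partial n) (pair n)) (0+ 0#)))

  -- Components that Jacobi's identity kills are the constant 0, the others are independent variables.
  cubeLeaf : ∀ r → Dec (Missing r) → Polynomial p
  cubeLeaf r (yes _) = con (+ 0)
  cubeLeaf r (no _)  = var (r mod p)

  cubeᴾ : ℕ → Polynomial p
  cubeᴾ r = cubeLeaf r (missing? r)

  cubeEnv : Env p
  cubeEnv = tabulate (λ i → component (toℕ i) cube)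

  cube-components : Components cubeEnv cube cubeᴾ
  cube-components = components λ {r} r<p → lemma r r<p (missing? r)
    where
    lemma : ∀ r → r ℕ.< p → (d : Dec (Missing r)) → component r cube ≈ˢ ⟦ cubeLeaf r d ⟧ cubeEnv
    lemma r r<p (yes missing) = component-cube missing
    lemma r r<p (no _) = ≈-reflexive (≡.sym (≡.trans (lookup∘tabulate (λ i → component (toℕ i) cube) (r mod p))
      (cong (λ s → component s cube) (≡.trans (Fin.toℕ-fromℕ< (m%n<n r p)) (m<n⇒m%n≡m r<p)))))

-- The moduli 5, 7 and 11

module Modulo5 (M : ℕ) where
  open QSeries 5 M
  open Dissection 5 M
  open Congruences 5 M
  open ModularSolver using (⟦_⟧; con; var; _:-_; _:*_; _:^_)
  open import Relation.Binary.Reasoning.Setoid setoid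

  freshman : Freshman
  freshman x = same-normal-form ((con (+ 1) :- var 0F) :^ 5) (con (+ 1) :- var 0F :^ 5) (x ∷ []) _

  component-4 : ∀ f → Homogeneous 0 (euler * f) → component 4 f ≈ˢ 0#
  component-4 f hom = component-quotient freshman f hom 3 2 refl 4 (begin
    component 4 (cube ^ 3)             ≈⟨ component-cong 4 (same-normal-form (var 0F :^ 3) (var 0F :* (var 0F :* var 0F)) (cube ∷ []) _) ⟩
    component 4 (cube * (cube * cube)) ≈⟨ component≈ (⊠-components cube-components (⊠-components cube-components cube-components)) (from-yes (4 ℕ.<? 5)) ⟩
    -- The classes left in E³ are 0 and 1, and three of them add up to at most 3.
    ⟦ (cubeᴾ ⊠ (cubeᴾ ⊠ cubeᴾ)) 4 ⟧ cubeEnv ≈⟨ same-normal-form ((cubeᴾ ⊠ (cubeᴾ ⊠ cubeᴾ)) 4) (con (+ 0)) cubeEnv _ ⟩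
    0#                                 ∎)

module Modulo7 (M : ℕ) where
  open QSeries 7 M
  open Dissection 7 M
  open Congruences 7 M
  open ModularSolver using (⟦_⟧; con; var; _:-_; _:*_; _:^_)
  open import Relation.Binary.Reasoning.Setoid setoid

  freshman : Freshman
  freshman x = same-normal-form ((con (+ 1) :- var 0F) :^ 7) (con (+ 1) :- var 0F :^ 7) (x ∷ []) _

  component-5 : ∀ f → Homogeneous 0 (euler * f) → component 5 f ≈ˢ 0#
  component-5 f hom = component-quotient freshman f hom 2 1 refl 5 (begin
    component 5 (cube ^ 2)    ≈⟨ component-cong 5 (same-normal-form (var 0F :^ 2) (var 0F :* var 0F) (cube ∷ []) _) ⟩
    component 5 (cube * cube) ≈⟨ component≈ (⊠-components cube-components cube-components) (from-yes (5 ℕ.<? 7)) ⟩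
    -- The classes left in E³ are 0, 1 and 3; no two of them add up to 5 modulo 7.
    ⟦ (cubeᴾ ⊠ cubeᴾ) 5 ⟧ cubeEnv ≈⟨ same-normal-form ((cubeᴾ ⊠ cubeᴾ) 5) (con (+ 0)) cubeEnv _ ⟩
    0#                        ∎)

module Modulo11 (M : ℕ) where
  open QSeries 11 M
  open Dissection 11 M
  open Congruences 11 M
  open ModularSolver using (Polynomial; ⟦_⟧; con; var; _:+_; _:-_; _:*_; _:^_)
  open import Relation.Binary.Reasoning.Setoid setoid

  freshman : Freshman
  freshman x = same-normal-form ((con (+ 1) :- var 0F) :^ 11) (con (+ 1) :- var 0F :^ 11) (x ∷ []) _

  cube²ᴾ cube³ᴾ cube⁴ᴾ : ℕ → Polynomial 11
  cube²ᴾ = cubeᴾ ⊠ cubeᴾ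
  cube³ᴾ = cubeᴾ ⊠ cube²ᴾ
  cube⁴ᴾ = cube²ᴾ ⊠ cube²ᴾ

  cube³ cube⁴ : Series
  cube³ = cube * (cube * cube)
  cube⁴ = cube * cube * (cube * cube)

  cube²-components : Components cubeEnv (cube * cube) cube²ᴾ
  cube²-components = ⊠-components cube-components cube-components

  cube³-components : Components cubeEnv cube³ cube³ᴾ
  cube³-components = ⊠-components cube-components cube²-components

  cube⁴-components : Components cubeEnv cube⁴ cube⁴ᴾ
  cube⁴-components = ⊠-components cube²-components cube²-components

  cube⁷-components : Components cubeEnv (cube⁴ * cube³) (cube⁴ᴾ ⊠ cube³ᴾ)
  cube⁷-components = ⊠-components cube⁴-components cube³-components

  component-cube⁴ : ∀ r → NotPentagonal r → component r cube⁴ ≈ˢ 0#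
  component-cube⁴ r notPentagonal = begin
    component r cube⁴                ≈⟨ component-cong r (same-normal-form
                                          (let e = var 0F; c = e :* e :* e in c :* c :* (c :* c)) (var 0F :^ 11 :* var 0F) (euler ∷ []) _) ⟩
    component r (euler ^ 11 * euler) ≈⟨ component-* (poch^p-homogeneous freshman M (Homogeneous-resp (*1 q) (Homogeneous-q^ 1))) r euler ⟩
    euler ^ 11 * component r euler   ≈⟨ *-≈ˡ (component-euler r notPentagonal) ⟩
    euler ^ 11 * 0#                  ≈⟨ *-zeroʳ _ ⟩
    0#                               ∎

  -- The class-6 component of (E³)⁷ is a combination of the vanishing components of (E³)⁴; the cofactors
  -- come from linear algebra modulo 11.
  cofactor : (x y z v : Polynomial 11) → Polynomial 11
  cofactor x y z v = con (+ 4) :* x :* x :* y :- z :* z :* z :- z :* y :* v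

  -- The surviving classes t = 0, 1, 3, 6, 10 correspond to the nonzero squares 8t + 1 = 1, 9, 3, 5,
  -- 4 modulo 11. Multiplication by a square permutes them. It fixes the class-6 form of (E³)⁷,
  -- where the numbers 8t + 1 sum to 0, and permutes the five vanishing forms of (E³)⁴, where they
  -- sum to a nonresidue. The cofactors form one orbit: those for 6, 8, 9, 10 arise from `cofactor₃`
  -- by multiplication by 5, 4, 9, 3.
  cofactor₃ cofactor₆ cofactor₈ cofactor₉ cofactor₁₀ : Polynomial 11
  cofactor₃  = cofactor (var (# 0))  (var (# 3))  (var (# 1))  (var (# 10))
  cofactor₆  = cofactor (var (# 6))  (var (# 10)) (var (# 0))  (var (# 1))
  cofactor₈  = cofactor (var (# 10)) (var (# 0))  (var (# 3))  (var (# 6))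
  cofactor₉  = cofactor (var (# 1))  (var (# 6))  (var (# 10)) (var (# 3))
  cofactor₁₀ = cofactor (var (# 3))  (var (# 1))  (var (# 6))  (var (# 0))

  cube⁷-relation : Polynomial 11
  cube⁷-relation = cofactor₃ :* cube⁴ᴾ 3 :+ cofactor₆ :* cube⁴ᴾ 6 :+ cofactor₈ :* cube⁴ᴾ 8
                :+ cofactor₉ :* cube⁴ᴾ 9 :+ cofactor₁₀ :* cube⁴ᴾ 10

  cube⁷≈relation : ⟦ (cube⁴ᴾ ⊠ cube³ᴾ) 6 ⟧ cubeEnv ≈ˢ ⟦ cube⁷-relation ⟧ cubeEnv
  cube⁷≈relation = same-normal-form ((cube⁴ᴾ ⊠ cube³ᴾ) 6) cube⁷-relation cubeEnv _

  relation-vanishes : ⟦ cube⁷-relation ⟧ cubeEnv ≈ˢ 0#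
  relation-vanishes = ≈-trans (+-≈ (+-≈ (+-≈ (+-≈
           (vanishing cofactor₃  3  (from-yes (3 ℕ.<? 11))  (from-yes (notPentagonal? 3)))
           (vanishing cofactor₆  6  (from-yes (6 ℕ.<? 11))  (from-yes (notPentagonal? 6))))
           (vanishing cofactor₈  8  (from-yes (8 ℕ.<? 11))  (from-yes (notPentagonal? 8))))
           (vanishing cofactor₉  9  (from-yes (9 ℕ.<? 11))  (from-yes (notPentagonal? 9))))
           (vanishing cofactor₁₀ 10 (from-yes (10 ℕ.<? 11)) (from-yes (notPentagonal? 10))))
    (same-normal-form (con (+ 0) :+ con (+ 0) :+ con (+ 0) :+ con (+ 0) :+ con (+ 0)) (con (+ 0)) [] _)
    where
    vanishing : ∀ (c : Polynomial 11) r → r ℕ.< 11 → NotPentagonal r → ⟦ c ⟧ cubeEnv * ⟦ cube⁴ᴾ r ⟧ cubeEnv ≈ˢ 0#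
    vanishing c r r<11 notPentagonal = ≈-trans
      (*-≈ˡ (≈-trans (≈-sym (component≈ cube⁴-components r<11)) (component-cube⁴ r notPentagonal)))
      (*-zeroʳ (⟦ c ⟧ cubeEnv))

  component-6-cube⁷ : component 6 (cube ^ 7) ≈ˢ 0#
  component-6-cube⁷ = ≈-trans
    (component-cong 6 (same-normal-form (var 0F :^ 7) (let c = var 0F in c :* c :* (c :* c) :* (c :* (c :* c))) (cube ∷ []) _))
    (≈-trans (component≈ cube⁷-components (from-yes (6 ℕ.<? 11))) (≈-trans cube⁷≈relation relation-vanishes))

  component-6 : ∀ f → Homogeneous 0 (euler * f) → component 6 f ≈ˢ 0#
  component-6 f hom = component-quotient freshman f hom 7 2 refl 6 component-6-cube⁷

-- Generating functions of p-regular partitions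

open import Defs

-- The recursive calls inherit one unit of fuel less, whereas `total` fixes the fuel by its own
-- arguments; independence of the fuel reconciles the two.
boundedParts-fuel : ∀ f g n m → n ℕ.+ m ℕ.≤ f → n ℕ.+ m ℕ.≤ g → boundedParts f n m ≡ boundedParts g n m
boundedParts-fuel f       g       zero    m       _  _  = refl
boundedParts-fuel (suc f) (suc g) (suc n) zero    _  _  = refl
boundedParts-fuel (suc f) (suc g) (suc n) (suc m) (ℕ.s≤s ≤f) (ℕ.s≤s ≤g) = cong₂ _++_
  (boundedParts-fuel f g (suc n) m (first ≤f) (first ≤g))
  (cong (λ ps → if does (suc m ≤? suc n) then map (suc m ∷_) ps else [])
    (boundedParts-fuel f g (n ∸ m) (suc m) (second ≤f) (second ≤g)))
  where
  first : ∀ {f} → n ℕ.+ suc m ℕ.≤ f → suc n ℕ.+ m ℕ.≤ f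
  first {f} = subst (ℕ._≤ f) (ℕ.+-suc n m)
  second : ∀ {f} → n ℕ.+ suc m ℕ.≤ f → n ∸ m ℕ.+ suc m ℕ.≤ f
  second = ℕ.≤-trans (ℕ.+-monoˡ-≤ (suc m) (ℕ.m∸n≤m n m))

boundedParts-bounded : ∀ f n m → All (All (ℕ._≤ m)) (boundedParts f n m)
boundedParts-bounded f       zero    m       = [] ∷ []
boundedParts-bounded zero    (suc n) m       = []
boundedParts-bounded (suc f) (suc n) zero    = []
boundedParts-bounded (suc f) (suc n) (suc m) =
  All.++⁺ (All.map (All.map ℕ.m≤n⇒m≤1+n) (boundedParts-bounded f (suc n) m)) (rest (does (suc m ≤? suc n)))
  where
  rest : ∀ b → All (All (ℕ._≤ suc m)) (if b then map (suc m ∷_) (boundedParts f (n ∸ m) (suc m)) else [])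
  rest true  = All.map⁺ (All.map (ℕ.≤-refl ∷_) (boundedParts-bounded f (n ∸ m) (suc m)))
  rest false = []

total : (List ℕ → ℕ) → ℕ → ℕ → ℕ
total Φ m n = sum (map Φ (boundedParts (n ℕ.+ m) n m))

total-cong : ∀ {Φ Ψ : List ℕ → ℕ} m n → (∀ {λs} → All (ℕ._≤ m) λs → Φ λs ≡ Ψ λs) → total Φ m n ≡ total Ψ m n
total-cong {Φ} {Ψ} m n Φ≡Ψ = go (boundedParts-bounded (n ℕ.+ m) n m)
  where
  go : ∀ {ps} → All (All (ℕ._≤ m)) ps → sum (map Φ ps) ≡ sum (map Ψ ps)
  go []         = refl
  go (≤m ∷ all) = cong₂ ℕ._+_ (Φ≡Ψ ≤m) (go all)

total-linear : ∀ (Φ Ψ : List ℕ → ℕ) c m n →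
               total (λ λs → Φ λs ℕ.+ c ℕ.* Ψ λs) m n ≡ total Φ m n ℕ.+ c ℕ.* total Ψ m n
total-linear Φ Ψ c m n = go (boundedParts (n ℕ.+ m) n m)
  where
  lemma : ∀ a b c d e → a ℕ.+ c ℕ.* b ℕ.+ (d ℕ.+ c ℕ.* e) ≡ a ℕ.+ d ℕ.+ c ℕ.* (b ℕ.+ e)
  lemma = ℕ.solve-∀
  base : ∀ c → 0 ≡ 0 ℕ.+ c ℕ.* 0
  base = ℕ.solve-∀
  go : ∀ ps → sum (map (λ λs → Φ λs ℕ.+ c ℕ.* Ψ λs) ps) ≡ sum (map Φ ps) ℕ.+ c ℕ.* sum (map Ψ ps)
  go []       = base c
  go (λs ∷ ps) = ≡.trans (cong (Φ λs ℕ.+ c ℕ.* Ψ λs ℕ.+_) (go ps)) (lemma (Φ λs) (Ψ λs) c _ _)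

total-suc-< : ∀ Φ m n → ¬ suc m ℕ.≤ n → total Φ (suc m) n ≡ total Φ m n
total-suc-< Φ m zero    _   = refl
total-suc-< Φ m (suc n) k≰n = cong (sum ∘ map Φ) (≡.trans
  (cong (λ b → boundedParts (n ℕ.+ suc m) (suc n) m ++ (if b then map (suc m ∷_) (boundedParts (n ℕ.+ suc m) (n ∸ m) (suc m)) else []))
    (dec-false (suc m ≤? suc n) k≰n))
  (≡.trans (++-identityʳ _)
    (boundedParts-fuel _ _ (suc n) m (ℕ.≤-reflexive (≡.sym (ℕ.+-suc n m))) ℕ.≤-refl)))

sum-map-++-map : ∀ (Φ : List ℕ → ℕ) k xs ys →
                 sum (map Φ (xs ++ map (k ∷_) ys)) ≡ sum (map Φ xs) ℕ.+ sum (map (Φ ∘ (k ∷_)) ys)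
sum-map-++-map Φ k xs ys = ≡.trans (cong sum (map-++ Φ xs (map (k ∷_) ys)))
  (≡.trans (sum-++ (map Φ xs) (map Φ (map (k ∷_) ys)))
    (cong (λ zs → sum (map Φ xs) ℕ.+ sum zs) (≡.sym (map-∘ {g = Φ} {f = k ∷_} ys))))

total-suc-≥ : ∀ Φ m j → total Φ (suc m) (suc m ℕ.+ j) ≡ total Φ m (suc m ℕ.+ j) ℕ.+ total (Φ ∘ (suc m ∷_)) (suc m) j
total-suc-≥ Φ m j = ≡.trans (cong (sum ∘ map Φ) (cong₂ _++_ left right))
  (sum-map-++-map Φ (suc m) (boundedParts (suc n ℕ.+ m) (suc n) m) (boundedParts (j ℕ.+ suc m) j (suc m)))
  where
  n = m ℕ.+ j
  left : boundedParts (n ℕ.+ suc m) (suc n) m ≡ boundedParts (suc n ℕ.+ m) (suc n) m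
  left = boundedParts-fuel _ _ (suc n) m (ℕ.≤-reflexive (≡.sym (ℕ.+-suc n m))) ℕ.≤-refl
  right : (if does (suc m ≤? suc n) then map (suc m ∷_) (boundedParts (n ℕ.+ suc m) (n ∸ m) (suc m)) else [])
          ≡ map (suc m ∷_) (boundedParts (j ℕ.+ suc m) j (suc m))
  right = ≡.trans
    (cong (λ b → if b then map (suc m ∷_) (boundedParts (n ℕ.+ suc m) (n ∸ m) (suc m)) else [])
      (dec-true (suc m ≤? suc n) (ℕ.m≤m+n (suc m) j)))
    (cong (map (suc m ∷_)) (≡.trans (cong (λ i → boundedParts (n ℕ.+ suc m) i (suc m)) (ℕ.m+n∸m≡n m j))
      (boundedParts-fuel _ _ j (suc m) (ℕ.+-monoˡ-≤ (suc m) (ℕ.m≤n+m j m)) ℕ.≤-refl)))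

-- Weights of partitions, and the effect of adding copies of a part

module Weights (p : ℕ) where

  -- Weight 0 on the excluded partitions replaces the filter, so that `total` is a plain sum and
  -- linear in the weight.
  ifFew : (List ℕ → ℕ) → List ℕ → ℕ
  ifFew w λs = if fewRepeats p λs then w λs else 0

  count weighted : List ℕ → ℕ
  count    = ifFew (λ _ → 1)
  weighted = ifFew (partsDivBy p)

  a≡total : ∀ n → a n p ≡ total weighted n n
  -- The fuel n + n of `partitions` is the fuel n + m of `total` at m = n, so both sides run over
  -- the same list by definition.
  a≡total n = go (partitions n)
    where
    go : ∀ ps → sum (map (partsDivBy p) (filter (λ λs → T? (fewRepeats p λs)) ps)) ≡ sum (map weighted ps)
    go []        = refl
    go (λs ∷ ps) with fewRepeats p λs
    ... | true  = cong (partsDivBy p λs ℕ.+_) (go ps)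
    ... | false = go ps

  module Stack (k : ℕ) where

    -- Copies are pushed inside, so that Φ ∘ stack c ∘ (k ∷_) is Φ ∘ stack (suc c) by computation.
    stack : ℕ → List ℕ → List ℕ
    stack zero    λs = λs
    stack (suc c) λs = stack c (k ∷ λs)

    divides? : ℕ
    divides? = if does (p ∣? k) then 1 else 0

    partsDivBy-stack : ∀ c λs → partsDivBy p (stack c λs) ≡ partsDivBy p λs ℕ.+ c ℕ.* divides?
    partsDivBy-stack zero    λs = ≡.sym (ℕ.+-identityʳ _)
    partsDivBy-stack (suc c) λs = ≡.trans (partsDivBy-stack c (k ∷ λs))
      (≡.trans (cong (ℕ._+ c ℕ.* divides?) step) (lemma (partsDivBy p λs) divides? (c ℕ.* divides?)))
      where
      lemma : ∀ x y z → y ℕ.+ x ℕ.+ z ≡ x ℕ.+ (y ℕ.+ z)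
      lemma = ℕ.solve-∀
      step : partsDivBy p (k ∷ λs) ≡ divides? ℕ.+ partsDivBy p λs
      step with does (p ∣? k)
      ... | true  = refl
      ... | false = refl

    mult-∷-≢ : ∀ {x} λs → k ≢ x → mult x (k ∷ λs) ≡ mult x λs
    mult-∷-≢ {x} λs k≢x = cong length (filter-reject (λ y → y ≟ x) k≢x)

    mult-stack-≢ : ∀ {x} c λs → k ≢ x → mult x (stack c λs) ≡ mult x λs
    mult-stack-≢ zero    λs k≢x = refl
    mult-stack-≢ (suc c) λs k≢x = ≡.trans (mult-stack-≢ c (k ∷ λs) k≢x) (mult-∷-≢ λs k≢x)

    mult-stack-≡ : ∀ c λs → mult k (stack c λs) ≡ c ℕ.+ mult k λs
    mult-stack-≡ zero    λs = refl
    mult-stack-≡ (suc c) λs = ≡.trans (mult-stack-≡ c (k ∷ λs))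
      (≡.trans (cong (c ℕ.+_) (cong length (filter-accept (λ y → y ≟ k) {k} {λs} refl))) (ℕ.+-suc c (mult k λs)))

    mult-absent : ∀ {λs} → All (ℕ._< k) λs → mult k λs ≡ 0
    mult-absent []           = refl
    mult-absent (x<k ∷ all<) = ≡.trans (cong length (filter-reject (λ y → y ≟ k) (ℕ.<⇒≢ x<k))) (mult-absent all<)

    all-stack-true : ∀ (f : ℕ → Bool) c λs → f k ≡ true → all f (stack c λs) ≡ all f λs
    all-stack-true f zero    λs fk = refl
    all-stack-true f (suc c) λs fk = ≡.trans (all-stack-true f c (k ∷ λs) fk) (cong (_∧ all f λs) fk)

    all-stack-false : ∀ (f : ℕ → Bool) c λs → all f λs ≡ false → all f (stack c λs) ≡ false
    all-stack-false f zero    λs e = e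
    all-stack-false f (suc c) λs e = all-stack-false f c (k ∷ λs) (≡.trans (cong (f k ∧_) e) (∧-zeroʳ (f k)))

    all-cong : ∀ {f g : ℕ → Bool} {λs} → All (ℕ._< k) λs → (∀ {x} → x ℕ.< k → f x ≡ g x) → all f λs ≡ all g λs
    all-cong []           f≡g = refl
    all-cong (x<k ∷ all<) f≡g = cong₂ _∧_ (f≡g x<k) (all-cong all< f≡g)

    few : List ℕ → ℕ → ℕ → Bool
    few λs c x = does (suc (mult x (stack c λs)) ≤? p)

    fewRepeats-stack-p : .{{_ : NonZero p}} → ∀ λs → fewRepeats p (stack p λs) ≡ false
    -- Writing p as a successor exposes a copy of `k` in the list, and it is at this entry that the
    -- test fails.
    fewRepeats-stack-p λs = ≡.trans (cong (λ c → all (few λs p) (stack c λs)) (≡.sym (ℕ.suc-pred p)))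
      (all-stack-false (few λs p) (ℕ.pred p) (k ∷ λs)
        (cong (_∧ all (few λs p) λs) (dec-false (_ ≤? p) (subst (λ y → ¬ y ℕ.< p) (≡.sym (mult-stack-≡ p λs)) (ℕ.m+n≮m p _)))))

    ifFew-stack-p : .{{_ : NonZero p}} → ∀ w λs → ifFew w (stack p λs) ≡ 0
    ifFew-stack-p w λs = cong (if_then w (stack p λs) else 0) (fewRepeats-stack-p λs)

    module _ {λs} (all< : All (ℕ._< k) λs) where

      mult-k : ∀ c → mult k (stack c λs) ≡ c
      mult-k c = ≡.trans (mult-stack-≡ c λs) (≡.trans (cong (c ℕ.+_) (mult-absent all<)) (ℕ.+-identityʳ c))

      -- Since the other parts are smaller than `k`, its multiplicity is exactly c, which passes the
      -- test; the multiplicities of the other parts are unchanged.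
      fewRepeats-stack-< : ∀ {c} → c ℕ.< p → fewRepeats p (stack c λs) ≡ fewRepeats p λs
      fewRepeats-stack-< {c} c<p = ≡.trans
        (all-stack-true (few λs c) c λs (dec-true (_ ≤? p) (subst (ℕ._< p) (≡.sym (mult-k c)) c<p)))
        (all-cong all< λ x<k → cong (λ y → does (suc y ≤? p)) (mult-stack-≢ c λs (≡.≢-sym (ℕ.<⇒≢ x<k))))

      count-stack : ∀ {c} → c ℕ.< p → count (stack c λs) ≡ count λs
      count-stack c<p = cong (if_then 1 else 0) (fewRepeats-stack-< c<p)

      weighted-stack : ∀ {c} → c ℕ.< p → weighted (stack c λs) ≡ weighted λs ℕ.+ (c ℕ.* divides?) ℕ.* count λs
      weighted-stack {c} c<p = ≡.trans
        (cong₂ (λ b w → if b then w else 0) (fewRepeats-stack-< c<p) (partsDivBy-stack c λs))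
        (lemma (fewRepeats p λs))
        where
        lemma : ∀ b → (if b then partsDivBy p λs ℕ.+ c ℕ.* divides? else 0) ≡
                      (if b then partsDivBy p λs else 0) ℕ.+ (c ℕ.* divides?) ℕ.* (if b then 1 else 0)
        lemma true  = cong (partsDivBy p λs ℕ.+_) (≡.sym (ℕ.*-identityʳ _))
        lemma false = ≡.sym (ℕ.*-zeroʳ (c ℕ.* divides?))

-- Recurrences for the generating functions

module Generating (p M : ℕ) .{{_ : NonZero p}} where
  open QSeries p M
  open Dissection p M
  open Theta p M
  open Congruences p M
  open Weights p
  private module K = CommutativeRing ring
  open IntegerSolver using (solve; _:=_; _:+_; _:*_; _:-_; con)
  open import Relation.Binary.Reasoning.Setoid setoid

  gen : (List ℕ → ℕ) → ℕ → Series
  gen Φ m n = + total Φ m n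

  gen-cong : ∀ {Φ Ψ} m → (∀ {λs} → All (ℕ._≤ m) λs → Φ λs ≡ Ψ λs) → gen Φ m ≈ˢ gen Ψ m
  gen-cong m Φ≡Ψ = coefficientwise λ {n} _ → ≡⇒≋ (cong +_ (total-cong m n Φ≡Ψ))

  gen-linear : ∀ Φ Ψ c m → gen (λ λs → Φ λs ℕ.+ c ℕ.* Ψ λs) m ≈ˢ gen Φ m + constant (+ c) * gen Ψ m
  gen-linear Φ Ψ c m = coefficientwise λ {n} _ → K.trans (≡⇒≋ (≡.trans (cong +_ (total-linear Φ Ψ c m n))
      (≡.trans (ℤ.pos-+ (total Φ m n) _) (cong (ℤ._+_ (gen Φ m n)) (ℤ.pos-* c (total Ψ m n))))))
    (K.trans (K.+-congˡ {gen Φ m n} (K.sym (⊛-constantˡ n (+ c) (gen Ψ m)))) (≡⇒≋ (≡.sym (⊕-at (gen Φ m) _ n))))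

  gen-suc : ∀ Φ m → gen Φ (suc m) ≈ˢ gen Φ m + q^ (suc m) * gen (Φ ∘ (suc m ∷_)) (suc m)
  gen-suc Φ m = coefficientwise λ {n} _ → lemma n
    where
    g = gen (Φ ∘ (suc m ∷_)) (suc m)
    lemma : ∀ n → gen Φ (suc m) n ≋ (gen Φ m + q^ (suc m) * g) n
    lemma n with suc m ≤? n
    ... | no k≰n  = K.trans (≡⇒≋ (cong +_ (total-suc-< Φ m n k≰n))) (K.trans (K.sym (K.+-identityʳ (gen Φ m n)))
      (K.trans (K.+-congˡ {gen Φ m n} (K.sym (q^*-below (suc m) g (ℕ.≰⇒> k≰n)))) (≡⇒≋ (≡.sym (⊕-at (gen Φ m) _ n)))))
    ... | yes k≤n = subst (λ n → gen Φ (suc m) n ≋ (gen Φ m + q^ (suc m) * g) n) (ℕ.m+[n∸m]≡n k≤n) (at-+ (n ∸ suc m))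
      where
      at-+ : ∀ j → gen Φ (suc m) (suc m ℕ.+ j) ≋ (gen Φ m + q^ (suc m) * g) (suc m ℕ.+ j)
      at-+ j = K.trans (≡⇒≋ (≡.trans (cong +_ (total-suc-≥ Φ m j)) (ℤ.pos-+ (total Φ m (suc m ℕ.+ j)) _)))
        (K.trans (K.+-congˡ {gen Φ m (suc m ℕ.+ j)} (K.sym (q^*-at (suc m) g j))) (≡⇒≋ (≡.sym (⊕-at (gen Φ m) _ (suc m ℕ.+ j)))))

  gen-zero : ∀ {Φ} m → (∀ {λs} → All (ℕ._≤ m) λs → Φ λs ≡ 0) → gen Φ m ≈ˢ 0#
  gen-zero {Φ} m Φ≡0 = coefficientwise λ {n} _ → ≡⇒≋ (≡.trans (cong +_ (vanish n (boundedParts-bounded (n ℕ.+ m) n m))) (≡.sym (0#-at n)))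
    where
    vanish : ∀ n {ps} → All (All (ℕ._≤ m)) ps → sum (map Φ ps) ≡ 0
    vanish n []         = refl
    vanish n (≤m ∷ all) = cong₂ ℕ._+_ (Φ≡0 ≤m) (vanish n all)

  module Step (m : ℕ) where
    open Stack (suc m)

    x : Series
    x = q^ (suc m)

    -- Partitions are sorted by their number c of copies of m + 1; the last summand gathers those
    -- with at least C copies. At C = p these all violate the bound on multiplicities.
    unroll : ∀ Φ C → gen Φ (suc m) ≈ˢ Σ< C (λ c → x ^ c * gen (Φ ∘ stack c) m) + x ^ C * gen (Φ ∘ stack C) (suc m)
    unroll Φ zero    = solve 1 (λ f → f := con (+ 0) :+ one :* f) ≈-refl (gen Φ (suc m))
    unroll Φ (suc C) = begin
      gen Φ (suc m)                                   ≈⟨ unroll Φ C ⟩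
      A + x ^ C * gen (Φ ∘ stack C) (suc m)           ≈⟨ +-≈ˡ (*-≈ˡ (gen-suc (Φ ∘ stack C) m)) ⟩
      A + x ^ C * (B + x * R)                         ≈⟨ solve 5 (λ A y B x R → A :+ y :* (B :+ x :* R) := y :* B :+ A :+ x :* y :* R) ≈-refl A (x ^ C) B x R ⟩
      x ^ C * B + A + x * x ^ C * R                   ∎
      where
      A = Σ< C (λ c → x ^ c * gen (Φ ∘ stack c) m)
      B = gen (Φ ∘ stack C) m
      R = gen (Φ ∘ stack (suc C)) (suc m)

    unroll-few : ∀ w → gen (ifFew w) (suc m) ≈ˢ Σ< p (λ c → x ^ c * gen (ifFew w ∘ stack c) m)
    unroll-few w = ≈-trans (unroll (ifFew w) p) (≈-trans (+-≈ˡ (≈-trans (*-≈ˡ rest) (*-zeroʳ (x ^ p)))) (+0 _))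
      where
      rest : gen (ifFew w ∘ stack p) (suc m) ≈ˢ 0#
      rest = gen-zero (suc m) (λ {λs} _ → ifFew-stack-p w λs)

    geometric arithmetic : Series
    geometric  = Σ< p (x ^_)
    arithmetic = Σ< p (λ c → x ^ c * constant (+ (c ℕ.* divides?)))

    gen-count-suc : gen count (suc m) ≈ˢ geometric * gen count m
    gen-count-suc = begin
      gen count (suc m)                                     ≈⟨ unroll-few (λ _ → 1) ⟩
      Σ< p (λ c → x ^ c * gen (count ∘ stack c) m)          ≈⟨ Σ<-cong p (λ c<p → *-≈ˡ (gen-cong m (λ ≤m → count-stack (All.map ℕ.s≤s ≤m) c<p))) ⟩
      Σ< p (λ c → x ^ c * gen count m)                      ≈⟨ Σ<-*ʳ p (x ^_) (gen count m) ⟨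
      geometric * gen count m                               ∎

    gen-weighted-suc : gen weighted (suc m) ≈ˢ geometric * gen weighted m + arithmetic * gen count m
    gen-weighted-suc = begin
      gen weighted (suc m)
        ≈⟨ unroll-few (partsDivBy p) ⟩
      Σ< p (λ c → x ^ c * gen (weighted ∘ stack c) m)
        ≈⟨ Σ<-cong p (λ {c} c<p → *-≈ˡ (≈-trans (gen-cong m (λ ≤m → weighted-stack (All.map ℕ.s≤s ≤m) c<p))
             (gen-linear weighted count (c ℕ.* divides?) m))) ⟩
      Σ< p (λ c → x ^ c * (gen weighted m + constant (+ (c ℕ.* divides?)) * gen count m))
        ≈⟨ split p ⟩
      geometric * gen weighted m + arithmetic * gen count m ∎
      where
      split : ∀ C → Σ< C (λ c → x ^ c * (gen weighted m + constant (+ (c ℕ.* divides?)) * gen count m)) ≈ˢ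
                    Σ< C (x ^_) * gen weighted m + Σ< C (λ c → x ^ c * constant (+ (c ℕ.* divides?))) * gen count m
      split zero    = solve 2 (λ S N → con (+ 0) := con (+ 0) :* S :+ con (+ 0) :* N) ≈-refl (gen weighted m) (gen count m)
      split (suc C) = ≈-trans (+-≈ˡ (split C))
        (solve 6 (λ y d S N A B → y :* (S :+ d :* N) :+ (A :* S :+ B :* N) := (y :+ A) :* S :+ (y :* d :+ B) :* N)
          ≈-refl (x ^ C) (constant (+ (C ℕ.* divides?))) (gen weighted m) (gen count m) _ _)

    telescope : (1- x) * geometric ≈ˢ 1- (x ^ p)
    telescope = go p
      where
      go : ∀ C → (1- x) * Σ< C (x ^_) ≈ˢ 1- (x ^ C)
      go zero    = solve 1 (λ x → (one :- x) :* con (+ 0) := one :- one) ≈-refl x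
      go (suc C) = begin
        (1- x) * (x ^ C + Σ< C (x ^_))          ≈⟨ solve 3 (λ x y G → (one :- x) :* (y :+ G) := (one :- x) :* G :+ y :- x :* y) ≈-refl x (x ^ C) _ ⟩
        (1- x) * Σ< C (x ^_) + x ^ C + - (x * x ^ C) ≈⟨ +-≈ʳ (+-≈ʳ (go C)) ⟩
        (1- (x ^ C)) + x ^ C + - (x * x ^ C)    ≈⟨ solve 2 (λ x y → one :- y :+ y :- x :* y := one :- x :* y) ≈-refl x (x ^ C) ⟩
        1- (x * x ^ C)                          ∎

    Homogeneous-1- : ∀ {f} → Homogeneous 0 f → Homogeneous 0 (1- f)
    Homogeneous-1- hf = Homogeneous-+ (Homogeneous-constant ℤ.1ℤ) (Homogeneous-neg hf)

    1-x^p-homogeneous : Homogeneous 0 (1- (x ^ p))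
    1-x^p-homogeneous = Homogeneous-1- (Homogeneous-~ (+p* 0 (suc m)) (Homogeneous-^ p (Homogeneous-q^ (suc m))))

    Σ<-homogeneous : ∀ C t → (∀ c → Homogeneous 0 (t c)) → Homogeneous 0 (Σ< C t)
    Σ<-homogeneous zero    t ht = Homogeneous-0
    Σ<-homogeneous (suc C) t ht = Homogeneous-+ (ht C) (Σ<-homogeneous C t ht)

    -- If p divides m + 1 then `x` itself is a power of qᵖ; otherwise copies of m + 1 are not
    -- counted and the sum is zero.
    [1-x]arithmetic-homogeneous : Homogeneous 0 ((1- x) * arithmetic)
    [1-x]arithmetic-homogeneous = cases (p ∣? suc m)
      where
      cases : Dec (p ∣ suc m) → Homogeneous 0 ((1- x) * arithmetic)
      cases (yes p∣k) = Homogeneous-* (Homogeneous-1- hx) (Σ<-homogeneous p _ λ c →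
          Homogeneous-* {0} {0} (Homogeneous-~ (cong (_% p) (ℕ.*-zeroʳ c)) (Homogeneous-^ c hx)) (Homogeneous-constant _))
        where
        hx : Homogeneous 0 x
        hx = Homogeneous-~ (≡.trans (n∣m⇒m%n≡0 (suc m) p p∣k) (≡.sym (m<n⇒m%n≡m (ℕ.>-nonZero⁻¹ p)))) (Homogeneous-q^ (suc m))
      cases (no p∤k) = Homogeneous-resp (≈-sym (≈-trans (*-≈ˡ (Σ<-zero p term≈0)) (*-zeroʳ _))) Homogeneous-0
        where
        divides?≡0 : divides? ≡ 0
        divides?≡0 = cong (if_then 1 else 0) (dec-false (p ∣? suc m) p∤k)
        term≈0 : ∀ c → x ^ c * constant (+ (c ℕ.* divides?)) ≈ˢ 0#
        term≈0 c = ≈-trans (*-≈ˡ (constant-cong (≡⇒≋ (cong +_ (≡.trans (cong (c ℕ.*_) divides?≡0) (ℕ.*-zeroʳ c)))))) (*-zeroʳ _)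

  open Step

  gen-0 : ∀ Φ → gen Φ 0 ≈ˢ constant (+ Φ [])
  gen-0 Φ = coefficientwise λ { {zero} _ → ≡⇒≋ (cong +_ (ℕ.+-identityʳ (Φ []))) ; {suc n} _ → K.refl }

  count-homogeneous : ∀ m → Homogeneous 0 (poch m q * gen count m)
  count-homogeneous zero    = Homogeneous-resp (≈-sym (1* _)) (Homogeneous-resp (≈-sym (gen-0 count)) (Homogeneous-constant _))
  count-homogeneous (suc m) = Homogeneous-resp (≈-sym (begin
      poch (suc m) q * gen count (suc m)
        ≈⟨ *-≈ (poch-snoc m q) (gen-count-suc m) ⟩
      poch m q * (1- x m) * (geometric m * gen count m)
        ≈⟨ solve 4 (λ P y G N → P :* y :* (G :* N) := y :* G :* (P :* N)) ≈-refl (poch m q) (1- x m) (geometric m) (gen count m) ⟩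
      (1- x m) * geometric m * (poch m q * gen count m)
        ≈⟨ *-≈ʳ (telescope m) ⟩
      (1- (x m ^ p)) * (poch m q * gen count m) ∎))
    (Homogeneous-* {0} {0} (1-x^p-homogeneous m) (count-homogeneous m))

  weighted-homogeneous : ∀ m → Homogeneous 0 (poch m q * gen weighted m)
  weighted-homogeneous zero    = Homogeneous-resp (≈-sym (1* _)) (Homogeneous-resp (≈-sym (gen-0 weighted)) (Homogeneous-constant _))
  weighted-homogeneous (suc m) = Homogeneous-resp (≈-sym (begin
      poch (suc m) q * gen weighted (suc m)
        ≈⟨ *-≈ (poch-snoc m q) (gen-weighted-suc m) ⟩
      poch m q * (1- x m) * (geometric m * gen weighted m + arithmetic m * gen count m)
        ≈⟨ solve 6 (λ P y G A S N → P :* y :* (G :* S :+ A :* N) := y :* G :* (P :* S) :+ y :* A :* (P :* N)) ≈-refl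
             (poch m q) (1- x m) (geometric m) (arithmetic m) (gen weighted m) (gen count m) ⟩
      (1- x m) * geometric m * (poch m q * gen weighted m) + (1- x m) * arithmetic m * (poch m q * gen count m)
        ≈⟨ +-≈ʳ (*-≈ʳ (telescope m)) ⟩
      (1- (x m ^ p)) * (poch m q * gen weighted m) + (1- x m) * arithmetic m * (poch m q * gen count m) ∎))
    (Homogeneous-+ (Homogeneous-* {0} {0} (1-x^p-homogeneous m) (weighted-homogeneous m))
      (Homogeneous-* {0} {0} ([1-x]arithmetic-homogeneous m) (count-homogeneous m)))

  -- The truncation order is the index of the wanted coefficient: parts of a partition of M are at
  -- most M, so stage M of the construction contains all of them.
  p∣a : ∀ r → M % p ≡ r % p → component r (gen weighted M) ≈ˢ 0# → p ∣ a M p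
  p∣a r M~r vanishing = subst (p ∣_) lemma (ℤ.∣⇒∣ᵤ (p∣a-b coefficient))
    where
    coefficient : gen weighted M M ≋ ℤ.0ℤ
    coefficient = K.trans (≡⇒≋ (≡.sym (component-on (gen weighted M) M~r))) (K.trans (at vanishing ℕ.≤-refl) (≡⇒≋ (0#-at M)))
    lemma : ℤ.∣ gen weighted M M ℤ.- ℤ.0ℤ ∣ ≡ a M p
    lemma = ≡.trans (cong ℤ.∣_∣ (ℤ.+-identityʳ (gen weighted M M))) (≡.sym (a≡total M))

open import Data.Nat using (_+_; _*_)

theorem4 : (n : ℕ) → (5 ∣ a (5 * n + 4) 5) × (7 ∣ a (7 * n + 5) 7) × (11 ∣ a (11 * n + 6) 11)
theorem4 n = modulo5 , modulo7 , modulo11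
  where
  modulo5 : 5 ∣ a (5 * n + 4) 5
  modulo5 = p∣a 4 (≡.trans (cong (_% 5) (ℕ.+-comm (5 * n) 4)) (Dissection.+p* 5 M 4 n))
              (Modulo5.component-4 M (gen weighted M) (weighted-homogeneous M))
    where
    M = 5 * n + 4
    open Generating 5 M
    open Weights 5
  modulo7 : 7 ∣ a (7 * n + 5) 7
  modulo7 = p∣a 5 (≡.trans (cong (_% 7) (ℕ.+-comm (7 * n) 5)) (Dissection.+p* 7 M 5 n))
              (Modulo7.component-5 M (gen weighted M) (weighted-homogeneous M))
    where
    M = 7 * n + 5
    open Generating 7 M
    open Weights 7
  modulo11 : 11 ∣ a (11 * n + 6) 11
  modulo11 = p∣a 6 (≡.trans (cong (_% 11) (ℕ.+-comm (11 * n) 6)) (Dissection.+p* 11 M 6 n))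
              (Modulo11.component-6 M (gen weighted M) (weighted-homogeneous M))
    where
    M = 11 * n + 6
    open Generating 11 M
    open Weights 11
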